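{- Let $q$ be a prime power with $q\equiv 1\pmod{52}$. Fix a primitive root $\alpha$ of $\mathbb{F}_q$ and set $\beta=\alpha^{(q-1)/13}$. The following statements are equivalent: (i) $(q,13)$ gives a $3$-design; (ii) $(q,26)$ gives a $3$-design; (iii) the sequence $(\chi(1-\beta),\chi(1-\beta^2),\dots,\chi(1-\beta^6))$ is one of $\pm(1,1,-1,1,-1,-1)$, $\pm(1,1,-1,-1,-1,1)$, $\pm(1,-1,1,1,-1,-1)$, $\pm(1,-1,1,-1,-1,1)$.
   Context: $\mathrm{PSL}(2,q)$ acts on the projective line $\mathrm{PG}(1,q)=\mathbb{F}_q\cup\{\infty\}$ by linear fractional transformations $z\mapsto (az+b)/(cz+d)$. For a prime power $q\equiv 1\pmod 4$ and a divisor $k$ of $q-1$, let $B$ be the unique subgroup of order $k$ of $\mathbb{F}_q^\times$. We say that $(q,k)$ gives a $3$-design if the $\mathrm{PSL}(2,q)$-orbit $\{gB: g\in\mathrm{PSL}(2,q)\}$ is the set of blocks of a $3$-$(q+1,k,\lambda)$ design on $\mathrm{PG}(1,q)$ for some positive integer $\lambda$. $\chi:\mathbb{F}_q^\times\to\{\pm1\}$ denotes the quadratic residue character ($\chi(a)=1$ iff $a$ is a nonzero square). -}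

module Defs where

open import Level using (0ℓ)
open import Data.Nat as ℕ using (ℕ; zero; suc)
open import Data.Fin using (Fin)
open import Data.Maybe using (Maybe; just; nothing)
open import Data.List using (List; length)
open import Data.List.Membership.Propositional using (_∈_)
open import Data.List.Relation.Unary.All using (All)
open import Data.List.Relation.Unary.AllPairs using (AllPairs)
open import Data.Product using (Σ; ∃; _×_; _,_)
open import Data.Sign using (Sign)
open import Data.Vec using (Vec; lookup)
open import Data.Empty using (⊥)
open import Relation.Nullary using (¬_; yes; no)
open import Relation.Binary.PropositionalEquality using (_≡_; _≢_)
open import Relation.Binary.Definitions using (DecidableEquality)
open import Algebra.Structures using (IsCommutativeRing)
open import Function.Bundles using (_↔_; _⇔_)

-- A finite field with exactly q elements (propositional equality,
-- decidable equality, and an explicit bijection with Fin q).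
-- The existence of such a field forces q to be a prime power.

record FiniteField (q : ℕ) : Set₁ where
  infixl 6 _+_
  infixl 7 _*_
  infixl 6 _-_
  infixr 8 _^_
  infix 9 -_
  infix 10 _⁻¹
  field
    Carrier   : Set
    _+_ _*_   : Carrier → Carrier → Carrier
    -_        : Carrier → Carrier
    0# 1#     : Carrier
    isCommutativeRing : IsCommutativeRing _≡_ _+_ _*_ -_ 0# 1#
    0≢1       : 0# ≢ 1#
    _⁻¹       : Carrier → Carrier
    ⁻¹-inverse : ∀ x → x ≢ 0# → x * (x ⁻¹) ≡ 1#
    _≟_       : DecidableEquality Carrier
    enumeration : Carrier ↔ Fin q

  _-_ : Carrier → Carrier → Carrier
  x - y = x + (- y)

  _^_ : Carrier → ℕ → Carrier
  x ^ zero  = 1#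
  x ^ suc n = x * (x ^ n)

module _ {q : ℕ} (F : FiniteField q) where
  open FiniteField F

  IsPrimitiveRoot : Carrier → Set
  IsPrimitiveRoot α = ∀ x → x ≢ 0# → ∃ λ n → α ^ n ≡ x

  IsSquare : Carrier → Set
  IsSquare a = ∃ λ y → y * y ≡ a

  ChiIs : Carrier → Sign → Set
  ChiIs a Sign.+ = a ≢ 0# × IsSquare a
  ChiIs a Sign.- = a ≢ 0# × ¬ IsSquare a

  -- The projective line PG(1,q) = F_q ∪ {∞}; nothing = ∞.
  Point : Set
  Point = Maybe Carrier

  -- Elements of PSL(2,q), represented by matrices of determinant 1
  -- (M and -M induce the same transformation).
  record PSL2 : Set where
    constructor mat
    field
      a b c d : Carrier
      det≡1   : a * d - b * c ≡ 1#

  act : PSL2 → Point → Point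
  act (mat a b c d _) nothing with c ≟ 0#
  ... | yes _ = nothing
  ... | no  _ = just (a * (c ⁻¹))
  act (mat a b c d _) (just z) with (c * z + d) ≟ 0#
  ... | yes _ = nothing
  ... | no  _ = just ((a * z + b) * ((c * z + d) ⁻¹))

  Subset : Set₁
  Subset = Carrier → Set

  HasSize : (Carrier → Set) → ℕ → Set
  HasSize P k = Σ (List Carrier) λ xs →
    AllPairs _≢_ xs × length xs ≡ k × (∀ x → P x ⇔ (x ∈ xs))

  IsSubgroupOfOrder : Subset → ℕ → Set
  IsSubgroupOfOrder B k =
      (∀ x → B x → x ≢ 0#)
    × B 1#
    × (∀ x y → B x → B y → B (x * y))
    × (∀ x → B x → B (x ⁻¹))
    × HasSize B k

  image : PSL2 → Subset → Point → Set
  image g B p = ∃ λ x → B x × act g (just x) ≡ p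

  SameBlock : PSL2 → PSL2 → Subset → Set
  SameBlock g h B = ∀ p → image g B p ⇔ image h B p

  Contains3 : PSL2 → Subset → Point → Point → Point → Set
  Contains3 g B p₁ p₂ p₃ = image g B p₁ × image g B p₂ × image g B p₃

  ExactlyBlocksContaining : Subset → ℕ → Point → Point → Point → Set
  ExactlyBlocksContaining B lam p₁ p₂ p₃ = Σ (List PSL2) λ gs →
      length gs ≡ lam
    × All (λ g → Contains3 g B p₁ p₂ p₃) gs
    × AllPairs (λ g h → ¬ SameBlock g h B) gs
    × (∀ g → Contains3 g B p₁ p₂ p₃ →
         Σ PSL2 λ h → h ∈ gs × SameBlock g h B)

  OrbitIs3Design : Subset → Set
  OrbitIs3Design B = Σ ℕ λ lam → 0 ℕ.< lam ×
    (∀ p₁ p₂ p₃ → p₁ ≢ p₂ → p₁ ≢ p₃ → p₂ ≢ p₃ →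
       ExactlyBlocksContaining B lam p₁ p₂ p₃)

  -- (q,k) gives a 3-design, B being the (unique) subgroup of order k
  Gives3Design : ℕ → Set₁
  Gives3Design k = ∀ (B : Subset) → IsSubgroupOfOrder B k → OrbitIs3Design B

  ChiSeqIs : Carrier → Vec Sign 6 → Set
  ChiSeqIs β s = ∀ (i : Fin 6) →
    ChiIs (1# - β ^ suc (Data.Fin.toℕ i)) (lookup s i)

open import Data.Vec using ([]; _∷_)
open import Data.List using ([]; _∷_)

admissible : List (Vec Sign 6)
admissible =
    (p ∷ p ∷ m ∷ p ∷ m ∷ m ∷ []) ∷ (m ∷ m ∷ p ∷ m ∷ p ∷ p ∷ [])
  ∷ (p ∷ p ∷ m ∷ m ∷ m ∷ p ∷ []) ∷ (m ∷ m ∷ p ∷ p ∷ p ∷ m ∷ [])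
  ∷ (p ∷ m ∷ p ∷ p ∷ m ∷ m ∷ []) ∷ (m ∷ p ∷ m ∷ m ∷ p ∷ p ∷ [])
  ∷ (p ∷ m ∷ p ∷ m ∷ m ∷ p ∷ []) ∷ (m ∷ p ∷ m ∷ p ∷ p ∷ m ∷ [])
  ∷ []
  where
    p m : Sign
    p = Sign.+
    m = Sign.-

{-# OPTIONS --safe #-}

-- Both PG(1,q) and its group are handled through the type τ(T) ∈ {±1} of an ordered triple T of distinct points,
-- the quadratic character of the product of the three 2 × 2 determinants of homogeneous coordinates.  PSL(2,q) acts
-- sharply transitively on the triples of each type, so the number of blocks g B through T, times the order of the
-- stabilizer of B, is the number of triples of B of type τ(T).  Hence the orbit of B is a 3-design iff B has as many
-- triples of type + as of type -.  For B = ⟨γ⟩ of order K a triple (γᶜ, γᶜ⁺ᵃ, γᶜ⁺ᵇ) has type f(a) f(|a - b|) f(b) with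
-- f(j) = χ(1 - γʲ), so only the finitely many sign patterns of f matter.  For K = 13 these are f(1), …, f(6).
-- For K = 26 the identity f(2j) = f(j) f(j + 13) expresses f through the same six signs and the one further sign
-- f(13) = χ(2), which turns out to be irrelevant.

module Submission where

open import Defs
open import Algebra.Bundles using (CommutativeRing)
import Algebra.Properties.AbelianGroup
import Algebra.Properties.Ring
import Algebra.Properties.Semiring.Mult.TCOptimised
import Algebra.Solver.Ring
open import Algebra.Solver.Ring.AlmostCommutativeRing
  using (AlmostCommutativeRing; fromCommutativeRing; _-Raw-AlmostCommutative⟶_)
open import Data.Fin as Fin using (Fin; toℕ)
import Data.Fin.Properties as Finₚ
open import Data.Integer as ℤ using (ℤ; +_; -[1+_]; _⊖_)
import Data.Integer.Properties as ℤₚ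
open import Data.List
  using (List; []; _∷_; _++_; allFin; cartesianProduct; cartesianProductWith; concatMap; filter; foldr; length
        ; map; upTo)
open import Data.List.Membership.Propositional using (_∈_; find)
open import Data.List.Membership.Propositional.Properties
import Data.List.Membership.DecPropositional
open import Data.List.Membership.Propositional.Properties.WithK using (unique∧set⇒bag)
open import Data.List.Properties
  using (filter-accept; filter-reject; length-++; length-++-sucʳ; length-map; length-tabulate; length-upTo)
open import Data.List.Relation.Binary.BagAndSetEquality using (∼bag⇒↭)
open import Data.List.Relation.Binary.Permutation.Propositional using (_↭_; ↭⇒↭ₛ)
open import Data.List.Relation.Binary.Permutation.Propositional.Properties using (↭-length)
open import Data.List.Relation.Binary.Permutation.Setoid.Properties using (foldr-commMonoid)
open import Data.List.Relation.Unary.All as All using (All; []; _∷_)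
open import Data.List.Relation.Unary.All.Properties using (¬Any⇒All¬)
open import Data.List.Relation.Unary.AllPairs as AllPairs using (AllPairs; []; _∷_)
import Data.List.Relation.Unary.AllPairs.Properties as AllPairsₚ
open import Data.List.Relation.Unary.Any as Any using (here; there)
open import Data.List.Relation.Unary.Unique.Propositional using (Unique)
import Data.List.Relation.Unary.Unique.Propositional.Properties as Uniqueₚ
open import Data.Maybe as Maybe using (just; nothing)
open import Data.Maybe.Properties using (just-injective; ≡-dec)
open import Data.Nat as ℕ using (ℕ; zero; suc; NonZero; _∸_; _/_; _%_; _<_; _≤_; ∣_-_∣; s≤s; z≤n)
open import Data.Nat.DivMod using (m≡m%n+[m/n]*n; m%n<n; m*n/n≡m)
open import Data.Nat.Divisibility using (_∣_; divides; m%n≡0⇒n∣m; ∣⇒≤; *-cancelˡ-∣; *-cancelʳ-∣)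
import Data.Nat.Properties as ℕₚ
open import Data.Product using (Σ; ∃; _×_; _,_; proj₁; proj₂)
open import Data.Sign as Sign using (Sign; opposite)
import Data.Sign.Properties as Signₚ
open import Data.Sum using (inj₁; inj₂)
open import Data.Vec using (Vec; []; _∷_; lookup; tabulate)
open import Data.Vec.Properties as Vecₚ using (lookup∘tabulate; tabulate∘lookup; tabulate-cong)
open import Function using (_∘_; case_of_; _⇔_; mk⇔; Equivalence; Injection; Inverse)
open import Function.Properties.Equivalence using () renaming (refl to ⇔-refl; sym to ⇔-sym; trans to ⇔-trans)
open import Function.Properties.Inverse using (↔⇒↣; ↔-sym)
open import Level using (Level; 0ℓ)
open import Relation.Binary as Binary using (Rel; Reflexive)
open import Relation.Binary.PropositionalEquality
open import Relation.Binary.PropositionalEquality.WithK using (≡-irrelevant)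
open import Relation.Nullary using (¬_; Dec; yes; no; ¬?; contradiction)
open import Relation.Nullary.Decidable using (True; dec⇒maybe; from-yes; map′; toWitness; _×-dec_; _→-dec_)
open import Relation.Unary using (Pred; Decidable)

-- Lists

-- The congruence q ≡ 1 (mod 52) does more than make 13 and 26 divide q - 1: it makes -1 a square
-- and both exponents (q - 1)/13 and (q - 1)/26 even, so the generators of both subgroups are
-- squares. Signs and common factors γᶜ therefore vanish inside χ, and the type of a triple of B
-- depends on differences of exponents only. The ± in the list is a symmetry: negating all six signs
-- negates every type. For K = 26 this holds because f is negated at even indices and unchanged at
-- odd ones, and among a, b and |a - b| either none or two are odd. The counting has to cope with
-- the encoding: a transformation has two matrices, a block comes from many transformations, and B
-- is an arbitrary predicate. Everything is counted through explicit lists of representatives modulo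
-- decidable relations; decidability starts from the identification of B with ⟨γ⟩.

private
  variable
    ℓ ℓ′ ℓ₁ ℓ₂ ℓ₃ : Level
    A : Set ℓ₁
    B : Set ℓ₂
    C : Set ℓ₃

-- Pigeonhole by deletion: the head of `xs` is cut out of `ys`, and the tail stays included because
-- it does not contain the head.
unique-⊆⇒length≤ : {xs ys : List A} → Unique xs → (∀ {x} → x ∈ xs → x ∈ ys) → length xs ≤ length ys
unique-⊆⇒length≤ [] _ = z≤n
unique-⊆⇒length≤ {xs = x ∷ xs} (x∉xs ∷ u) xs⊆ys with ∈-∃++ (xs⊆ys (here refl))
... | as , bs , refl = subst (suc (length xs) ≤_) (sym (length-++-sucʳ as x bs))
                         (s≤s (unique-⊆⇒length≤ u xs⊆as++bs))
  where
  xs⊆as++bs : ∀ {z} → z ∈ xs → z ∈ as ++ bs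
  xs⊆as++bs z∈xs with ∈-++⁻ as (xs⊆ys (there z∈xs))
  ... | inj₁ z∈as         = ∈-++⁺ˡ z∈as
  ... | inj₂ (here refl)  = contradiction refl (All.lookup x∉xs z∈xs)
  ... | inj₂ (there z∈bs) = ∈-++⁺ʳ as z∈bs

-- Greedy choice of representatives. With `SameBlock` it lists each block through three points once;
-- with `Agree` it lists each element of the stabilizer once, although every transformation has two
-- matrices.
transversal : {P : Pred A ℓ} (P? : Decidable P) {_≈_ : Rel A ℓ′} (_≈?_ : Binary.Decidable _≈_) → Reflexive _≈_ →
  (xs : List A) → Σ (List A) λ ys →
    All P ys × AllPairs (λ x y → ¬ (x ≈ y)) ys × (∀ {x} → x ∈ xs → P x → ∃ λ y → y ∈ ys × x ≈ y)
transversal P? _≈?_ ≈-refl [] = [] , [] , [] , λ ()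
transversal {P = P} P? {_≈_} _≈?_ ≈-refl (x ∷ xs) with transversal P? _≈?_ ≈-refl xs
... | ys , Pys , distinct , covers with P? x
...   | no ¬Px = ys , Pys , distinct , λ where
        (here refl) Px → contradiction Px ¬Px
        (there z∈xs) Pz → covers z∈xs Pz
...   | yes Px with Any.any? (x ≈?_) ys
...     | yes x≈ys = ys , Pys , distinct , λ where
          (here refl) _ → find x≈ys
          (there z∈xs) Pz → covers z∈xs Pz
...     | no x≉ys = x ∷ ys , Px ∷ Pys , ¬Any⇒All¬ ys x≉ys ∷ distinct , λ where
          (here refl) _ → x , here refl , ≈-refl
          (there z∈xs) Pz → let y , y∈ys , z≈y = covers z∈xs Pz in y , there y∈ys , z≈y

-- The relations `R` and `S` replace plain inequality because the factors will be lists of matrices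
-- that are pairwise distinct as blocks or as transformations; membership in `ys` gives `R⇒≢` access
-- to the stabilizing property.
cartesianProductWith-unique : {R : Rel A ℓ} {S : Rel B ℓ′} {f : A → B → C} {ys : List B} →
  (∀ {x x′ y y′} → R x x′ → y ∈ ys → y′ ∈ ys → f x y ≢ f x′ y′) →
  (∀ x {y y′} → S y y′ → f x y ≢ f x y′) →
  ∀ {xs} → AllPairs R xs → AllPairs S ys → Unique (cartesianProductWith f xs ys)
cartesianProductWith-unique R⇒≢ S⇒≢ [] _ = []
cartesianProductWith-unique {f = f} {ys} R⇒≢ S⇒≢ {x ∷ xs} (Rx ∷ Rxs) Sys =
  AllPairsₚ.++⁺ (AllPairsₚ.map⁺ (AllPairs.map (S⇒≢ x) Sys)) (cartesianProductWith-unique R⇒≢ S⇒≢ Rxs Sys)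
    (All.tabulate λ v∈ → All.tabulate λ w∈ v≡w → disjoint v∈ (subst (_∈ _) (sym v≡w) w∈))
  where
  disjoint : ∀ {v} → v ∈ map (f x) ys → ¬ (v ∈ cartesianProductWith f xs ys)
  disjoint v∈ v∈′ with ∈-map⁻ (f x) v∈ | ∈-cartesianProductWith⁻ f xs ys v∈′
  ... | y , y∈ , v≡ | x′ , y′ , x′∈ , y′∈ , v≡′ = R⇒≢ (All.lookup Rx x′∈) y∈ y′∈ (trans (sym v≡) v≡′)

length-cartesianProductWith : (f : A → B → C) → ∀ xs ys →
  length (cartesianProductWith f xs ys) ≡ length xs ℕ.* length ys
length-cartesianProductWith f [] ys = refl
length-cartesianProductWith f (x ∷ xs) ys = trans (length-++ (map (f x) ys))
  (cong₂ ℕ._+_ (length-map (f x) ys) (length-cartesianProductWith f xs ys))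

unique∧set⇒length≡ : {xs ys : List A} → Unique xs → Unique ys →
  (∀ {x} → x ∈ xs ⇔ x ∈ ys) → length xs ≡ length ys
unique∧set⇒length≡ xs! ys! eq = ↭-length (∼bag⇒↭ (unique∧set⇒bag xs! ys! eq))

length-filter-cong : {P : Pred A ℓ} {Q : Pred A ℓ′} (P? : Decidable P) (Q? : Decidable Q) →
  ∀ {xs} → (∀ {x} → x ∈ xs → P x ⇔ Q x) → length (filter P? xs) ≡ length (filter Q? xs)
length-filter-cong P? Q? {[]} _ = refl
length-filter-cong P? Q? {x ∷ xs} P⇔Q with P? x
... | yes Px = trans (cong suc (length-filter-cong P? Q? (P⇔Q ∘ there)))
  (sym (cong length (filter-accept Q? (Equivalence.to (P⇔Q (here refl)) Px))))
... | no ¬Px = trans (length-filter-cong P? Q? (P⇔Q ∘ there))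
  (sym (cong length (filter-reject Q? (¬Px ∘ Equivalence.from (P⇔Q (here refl))))))

AllPairs-map-∈ : {R : Rel A ℓ} {S : Rel A ℓ′} {xs : List A} →
  (∀ {x y} → x ∈ xs → y ∈ xs → R x y → S x y) → AllPairs R xs → AllPairs S xs
AllPairs-map-∈ R⇒S [] = []
AllPairs-map-∈ R⇒S (Rx ∷ Rxs) = All.tabulate (λ y∈ → R⇒S (here refl) (there y∈) (All.lookup Rx y∈))
  ∷ AllPairs-map-∈ (λ x∈ y∈ → R⇒S (there x∈) (there y∈)) Rxs

-- Finite fields

module FieldProperties {q : ℕ} (F : FiniteField q) where
  open FiniteField F

  commutativeRing : CommutativeRing 0ℓ 0ℓ
  commutativeRing = record { isCommutativeRing = isCommutativeRing }

  open CommutativeRing commutativeRing public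
    using (ring; semiring; +-abelianGroup; +-assoc; +-comm; +-identityˡ; +-identityʳ;
           -‿inverseʳ; *-assoc; *-comm; *-identityˡ; *-identityʳ; zeroˡ; zeroʳ; *-isCommutativeMonoid)
  open Algebra.Properties.Ring ring using (-‿distribˡ-*; -‿distribʳ-*; -0#≈0#; -‿involutive)
  open Algebra.Properties.AbelianGroup +-abelianGroup using (⁻¹-∙-comm)

  -- Integer coefficients let the ring solver cancel terms in an abstract ring.
  private
    module Mult = Algebra.Properties.Semiring.Mult.TCOptimised semiring

    infix 10 _·1
    _·1 : ℕ → Carrier
    n ·1 = n Mult.× 1#

    fromℤ : ℤ → Carrier
    fromℤ (+ n)    = n ·1
    fromℤ -[1+ n ] = - (suc n ·1)

    fromℤ-⊖ : ∀ m n → fromℤ (m ⊖ n) ≡ m ·1 - n ·1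
    fromℤ-⊖ m zero = sym (trans (cong (λ z → m ·1 + z) -0#≈0#) (+-identityʳ _))
    fromℤ-⊖ zero (suc n) = sym (+-identityˡ _)
    fromℤ-⊖ (suc m) (suc n) = begin
      fromℤ (suc m ⊖ suc n)                ≡⟨ cong fromℤ (ℤₚ.[1+m]⊖[1+n]≡m⊖n m n) ⟩
      fromℤ (m ⊖ n)                        ≡⟨ fromℤ-⊖ m n ⟩
      m ·1 - n ·1                          ≡⟨ cong (m ·1 +_) (sym (+-identityˡ _)) ⟩
      m ·1 + (0# - n ·1)                   ≡⟨ cong (λ z → m ·1 + (z - n ·1)) (sym (-‿inverseʳ 1#)) ⟩
      m ·1 + (1# - 1# - n ·1)              ≡⟨ cong (m ·1 +_) (+-assoc _ _ _) ⟩
      m ·1 + (1# + (- 1# - n ·1))          ≡⟨ sym (+-assoc _ _ _) ⟩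
      m ·1 + 1# + (- 1# - n ·1)            ≡⟨ cong₂ _+_ (+-comm _ _) (⁻¹-∙-comm _ _) ⟩
      (1# + m ·1) - (1# + n ·1)            ≡⟨ sym (cong₂ _-_ (Mult.1+× m 1#) (Mult.1+× n 1#)) ⟩
      suc m ·1 - suc n ·1                  ∎
      where open ≡-Reasoning

    fromℤ-+ : ∀ i j → fromℤ (i ℤ.+ j) ≡ fromℤ i + fromℤ j
    fromℤ-+ (+ m) (+ n) = Mult.×-homo-+ 1# m n
    fromℤ-+ (+ m) -[1+ n ] = fromℤ-⊖ m (suc n)
    fromℤ-+ -[1+ m ] (+ n) = trans (fromℤ-⊖ n (suc m)) (+-comm _ _)
    fromℤ-+ -[1+ m ] -[1+ n ] = begin
      - (suc (suc (m ℕ.+ n)) ·1)        ≡⟨ cong (λ k → - (suc k ·1)) (sym (ℕₚ.+-suc m n)) ⟩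
      - ((suc m ℕ.+ suc n) ·1)          ≡⟨ cong -_ (Mult.×-homo-+ 1# (suc m) (suc n)) ⟩
      - (suc m ·1 + suc n ·1)           ≡⟨ sym (⁻¹-∙-comm _ _) ⟩
      - (suc m ·1) - suc n ·1           ∎
      where open ≡-Reasoning

    fromℤ-neg : ∀ i → fromℤ (ℤ.- i) ≡ - fromℤ i
    fromℤ-neg (+ zero) = sym -0#≈0#
    fromℤ-neg (+ suc n) = refl
    fromℤ-neg -[1+ n ] = sym (-‿involutive _)

    fromℤ-* : ∀ i j → fromℤ (i ℤ.* j) ≡ fromℤ i * fromℤ j
    fromℤ-* (+ m) (+ n) = trans (cong fromℤ (sym (ℤₚ.pos-* m n))) (Mult.×1-homo-* m n)
    fromℤ-* (+ m) -[1+ n ] = begin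
      fromℤ (Sign.- ℤ.◃ (m ℕ.* suc n)) ≡⟨ cong fromℤ (ℤₚ.-◃n≡-n (m ℕ.* suc n)) ⟩
      fromℤ (ℤ.- + (m ℕ.* suc n))      ≡⟨ fromℤ-neg (+ (m ℕ.* suc n)) ⟩
      - ((m ℕ.* suc n) ·1)             ≡⟨ cong -_ (Mult.×1-homo-* m (suc n)) ⟩
      - (m ·1 * suc n ·1)              ≡⟨ -‿distribʳ-* _ _ ⟩
      m ·1 * - (suc n ·1)              ∎
      where open ≡-Reasoning
    fromℤ-* -[1+ m ] (+ n) = begin
      fromℤ (Sign.- ℤ.◃ (suc m ℕ.* n)) ≡⟨ cong fromℤ (ℤₚ.-◃n≡-n (suc m ℕ.* n)) ⟩
      fromℤ (ℤ.- + (suc m ℕ.* n))      ≡⟨ fromℤ-neg (+ (suc m ℕ.* n)) ⟩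
      - ((suc m ℕ.* n) ·1)             ≡⟨ cong -_ (Mult.×1-homo-* (suc m) n) ⟩
      - (suc m ·1 * n ·1)              ≡⟨ -‿distribˡ-* _ _ ⟩
      - (suc m ·1) * n ·1              ∎
      where open ≡-Reasoning
    fromℤ-* -[1+ m ] -[1+ n ] = begin
      (suc m ℕ.* suc n) ·1             ≡⟨ Mult.×1-homo-* (suc m) (suc n) ⟩
      suc m ·1 * suc n ·1              ≡⟨ sym (-‿involutive _) ⟩
      - - (suc m ·1 * suc n ·1)        ≡⟨ cong -_ (-‿distribʳ-* _ _) ⟩
      - (suc m ·1 * - (suc n ·1))      ≡⟨ -‿distribˡ-* _ _ ⟩
      - (suc m ·1) * - (suc n ·1)      ∎
      where open ≡-Reasoning

    almostCommutativeRing : AlmostCommutativeRing 0ℓ 0ℓ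
    almostCommutativeRing = fromCommutativeRing commutativeRing

    fromℤ-morphism : CommutativeRing.rawRing ℤₚ.+-*-commutativeRing -Raw-AlmostCommutative⟶ almostCommutativeRing
    fromℤ-morphism = record
      { ⟦_⟧ = fromℤ ; +-homo = fromℤ-+ ; *-homo = fromℤ-* ; -‿homo = fromℤ-neg ; 0-homo = refl ; 1-homo = refl }

  open Algebra.Solver.Ring (CommutativeRing.rawRing ℤₚ.+-*-commutativeRing) almostCommutativeRing fromℤ-morphism
    (λ i j → Maybe.map (cong fromℤ) (dec⇒maybe (i ℤ.≟ j))) public
    using (solve; _:=_; _:+_; _:*_; _:-_; :-_; con)

  *-≢0 : ∀ {x y} → x ≢ 0# → y ≢ 0# → x * y ≢ 0#
  *-≢0 {x} {y} x≢0 y≢0 xy≡0 = y≢0 (begin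
    y                 ≡⟨ sym (*-identityˡ y) ⟩
    1# * y            ≡⟨ cong (_* y) (sym (⁻¹-inverse x x≢0)) ⟩
    x * x ⁻¹ * y      ≡⟨ solve 3 (λ x i y → x :* i :* y := i :* (x :* y)) refl x (x ⁻¹) y ⟩
    x ⁻¹ * (x * y)    ≡⟨ cong (x ⁻¹ *_) xy≡0 ⟩
    x ⁻¹ * 0#         ≡⟨ zeroʳ _ ⟩
    0#                ∎)
    where open ≡-Reasoning

  x*y≡0⇒y≡0 : ∀ {x y} → x ≢ 0# → x * y ≡ 0# → y ≡ 0#
  x*y≡0⇒y≡0 {x} {y} x≢0 xy≡0 with y ≟ 0#
  ... | yes y≡0 = y≡0
  ... | no  y≢0 = contradiction xy≡0 (*-≢0 x≢0 y≢0)

  1≢0 : 1# ≢ 0#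
  1≢0 1≡0 = 0≢1 (sym 1≡0)

  ⁻¹-≢0 : ∀ {x} → x ≢ 0# → x ⁻¹ ≢ 0#
  ⁻¹-≢0 {x} x≢0 x⁻¹≡0 = 1≢0 (trans (sym (⁻¹-inverse x x≢0)) (trans (cong (x *_) x⁻¹≡0) (zeroʳ x)))

  x-y≡0⇒x≡y : ∀ {x y} → x - y ≡ 0# → x ≡ y
  x-y≡0⇒x≡y {x} {y} x-y≡0 = trans (solve 2 (λ x y → x := x :- y :+ y) refl x y)
    (trans (cong (_+ y) x-y≡0) (+-identityˡ y))

  neg-≢0 : ∀ {x} → x ≢ 0# → - x ≢ 0#
  neg-≢0 {x} x≢0 -x≡0 = x≢0 (trans (sym (-‿involutive x)) (trans (cong -_ -x≡0) -0#≈0#))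

  x≡y⇒x-y≡0 : ∀ {x y} → x ≡ y → x - y ≡ 0#
  x≡y⇒x-y≡0 {x} refl = -‿inverseʳ x

  *-cancelˡ : ∀ {x y z} → x ≢ 0# → x * y ≡ x * z → y ≡ z
  *-cancelˡ {x} {y} {z} x≢0 xy≡xz = x-y≡0⇒x≡y (x*y≡0⇒y≡0 x≢0
    (trans (solve 3 (λ x y z → x :* (y :- z) := x :* y :- x :* z) refl x y z) (x≡y⇒x-y≡0 xy≡xz)))

  *-≢0ˡ : ∀ {x y} → x * y ≢ 0# → x ≢ 0#
  *-≢0ˡ {y = y} xy≢0 refl = xy≢0 (zeroˡ y)

  ^-+ : ∀ x m n → x ^ (m ℕ.+ n) ≡ x ^ m * x ^ n
  ^-+ x zero n = sym (*-identityˡ _)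
  ^-+ x (suc m) n = trans (cong (x *_) (^-+ x m n)) (sym (*-assoc _ _ _))

  1^ : ∀ n → 1# ^ n ≡ 1#
  1^ zero = refl
  1^ (suc n) = trans (*-identityˡ _) (1^ n)

  ^-* : ∀ x m n → x ^ (m ℕ.* n) ≡ (x ^ m) ^ n
  ^-* x m zero = cong (x ^_) (ℕₚ.*-zeroʳ m)
  ^-* x m (suc n) = trans (cong (x ^_) (ℕₚ.*-suc m n)) (trans (^-+ x m (m ℕ.* n)) (cong (x ^ m *_) (^-* x m n)))

  ^-≢0 : ∀ {x} → x ≢ 0# → ∀ n → x ^ n ≢ 0#
  ^-≢0 x≢0 zero = 1≢0
  ^-≢0 x≢0 (suc n) = *-≢0 x≢0 (^-≢0 x≢0 n)

  x^d≡1⇒x^n≡x^[n%d] : ∀ {x} d .{{_ : NonZero d}} → x ^ d ≡ 1# → ∀ n → x ^ n ≡ x ^ (n % d)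
  x^d≡1⇒x^n≡x^[n%d] {x} d xᵈ≡1 n = begin
    x ^ n                                   ≡⟨ cong (x ^_) (m≡m%n+[m/n]*n n d) ⟩
    x ^ (n % d ℕ.+ n ℕ./ d ℕ.* d)           ≡⟨ ^-+ x (n % d) _ ⟩
    x ^ (n % d) * x ^ (n ℕ./ d ℕ.* d)       ≡⟨ cong (λ m → x ^ (n % d) * x ^ m) (ℕₚ.*-comm (n ℕ./ d) d) ⟩
    x ^ (n % d) * x ^ (d ℕ.* (n ℕ./ d))     ≡⟨ cong (x ^ (n % d) *_) (^-* x d _) ⟩
    x ^ (n % d) * (x ^ d) ^ (n ℕ./ d)       ≡⟨ cong (λ z → x ^ (n % d) * z ^ (n ℕ./ d)) xᵈ≡1 ⟩
    x ^ (n % d) * 1# ^ (n ℕ./ d)            ≡⟨ cong (x ^ (n % d) *_) (1^ (n ℕ./ d)) ⟩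
    x ^ (n % d) * 1#                        ≡⟨ *-identityʳ _ ⟩
    x ^ (n % d)                             ∎
    where open ≡-Reasoning

  x^m≡x^[m+d]⇒x^d≡1 : ∀ {x} → x ≢ 0# → ∀ m d → x ^ m ≡ x ^ (m ℕ.+ d) → x ^ d ≡ 1#
  x^m≡x^[m+d]⇒x^d≡1 {x} x≢0 m d eq =
    *-cancelˡ (^-≢0 x≢0 m) (trans (sym (trans eq (^-+ x m d))) (sym (*-identityʳ _)))

-- The quadratic character

parity : ℕ → Sign
parity zero    = Sign.+
parity (suc n) = opposite (parity n)

parity-+ : ∀ m n → parity (m ℕ.+ n) ≡ parity m Sign.* parity n
parity-+ zero n = refl
parity-+ (suc m) n = trans (cong opposite (parity-+ m n)) (sym (Signₚ.*-assoc Sign.- (parity m) (parity n)))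

parity-*2 : ∀ n → parity (n ℕ.* 2) ≡ Sign.+
parity-*2 zero    = refl
parity-*2 (suc n) = trans (Signₚ.opposite-involutive _) (parity-*2 n)

parity≡+⇒even : ∀ n → parity n ≡ Sign.+ → ∃ λ m → n ≡ m ℕ.+ m
parity≡+⇒even zero _ = 0 , refl
parity≡+⇒even (suc (suc n)) even with parity≡+⇒even n (trans (sym (Signₚ.opposite-involutive _)) even)
... | m , n≡2m = suc m , cong suc (trans (cong suc n≡2m) (sym (ℕₚ.+-suc m m)))

module Enumeration {q : ℕ} (F : FiniteField q) where
  open FiniteField F
  open Inverse enumeration using (to; from; strictlyInverseʳ)

  elements : List Carrier
  elements = map from (allFin q)

  ∈-elements : ∀ x → x ∈ elements
  ∈-elements x = subst (_∈ elements) (strictlyInverseʳ x) (∈-map⁺ from (∈-allFin (to x)))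

  length-elements : length elements ≡ q
  length-elements = trans (length-map from (allFin q)) (length-tabulate (λ i → i))

  elements-unique : Unique elements
  elements-unique = Uniqueₚ.map⁺ (Injection.injective (↔⇒↣ (↔-sym enumeration))) (Uniqueₚ.allFin⁺ q)

  -- Turns a list of powers that covers the nonzero elements into a lower bound for an order.
  q≤1+length : ∀ {ys} → (∀ x → x ≢ 0# → x ∈ ys) → q ≤ suc (length ys)
  q≤1+length {ys} nonzero∈ys = subst (_≤ suc (length ys)) length-elements (unique-⊆⇒length≤ elements-unique sub)
    where
    sub : ∀ {x} → x ∈ elements → x ∈ 0# ∷ ys
    sub {x} _ with x ≟ 0#
    ... | yes x≡0 = here x≡0
    ... | no  x≢0 = there (nonzero∈ys x x≢0)

  2≤q : 2 ≤ q
  2≤q = subst (2 ≤_) length-elements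
    (unique-⊆⇒length≤ {xs = 0# ∷ 1# ∷ []} ((0≢1 ∷ []) ∷ [] ∷ []) (λ {x} _ → ∈-elements x))

module PrimitiveRoot {q : ℕ} (F : FiniteField q) (k : ℕ) (q≡1+52k : q ≡ suc (k ℕ.* 52))
  (α : FiniteField.Carrier F) (generates : IsPrimitiveRoot F α) where
  open FiniteField F
  open FieldProperties F
  open Enumeration F

  N : ℕ
  N = k ℕ.* 52

  1≤k : 1 ≤ k
  1≤k = go k (subst (2 ≤_) q≡1+52k 2≤q)
    where
    go : ∀ k → 2 ≤ suc (k ℕ.* 52) → 1 ≤ k
    go zero (s≤s ())
    go (suc k) _ = s≤s z≤n

  instance
    k≢0 : NonZero k
    k≢0 = ℕ.>-nonZero 1≤k

    N≢0 : NonZero N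
    N≢0 = ℕₚ.m*n≢0 k 52

  -- The only nonzero power of 0 is 0⁰ = 1, so α = 0 would force q ≤ 2. `IsPrimitiveRoot` alone
  -- admits 0 in the field of two elements.
  α≢0 : α ≢ 0#
  α≢0 α≡0 = go k (subst (_≤ 2) q≡1+52k (q≤1+length {1# ∷ []} nonzero≡1)) 1≤k
    where
    nonzero≡1 : ∀ x → x ≢ 0# → x ∈ 1# ∷ []
    nonzero≡1 x x≢0 with generates x x≢0
    ... | zero  , refl = here refl
    ... | suc n , refl = contradiction (trans (cong (_* α ^ n) α≡0) (zeroˡ _)) x≢0
    go : ∀ k → suc (k ℕ.* 52) ≤ 2 → ¬ 1 ≤ k
    go (suc k) (s≤s (s≤s ()))

  α^-≢0 : ∀ n → α ^ n ≢ 0#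
  α^-≢0 = ^-≢0 α≢0

  -- If αᵈ = 1, the exponents below `d` already produce all q - 1 nonzero elements.
  α^d≡1⇒N≤d : ∀ d .{{_ : NonZero d}} → α ^ d ≡ 1# → N ≤ d
  α^d≡1⇒N≤d d αᵈ≡1 = ℕ.s≤s⁻¹ (subst₂ _≤_ q≡1+52k
    (cong suc (trans (length-map (α ^_) (upTo d)) (length-upTo d))) (q≤1+length powers))
    where
    powers : ∀ x → x ≢ 0# → x ∈ map (α ^_) (upTo d)
    powers x x≢0 with generates x x≢0
    ... | n , refl = subst (_∈ _) (sym (x^d≡1⇒x^n≡x^[n%d] d αᵈ≡1 n)) (∈-map⁺ (α ^_) (∈-upTo⁺ (m%n<n n d)))

  -- 0, α⁰, …, α^(q-1) are q + 1 elements of a set of size q.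
  α^N≡1 : α ^ N ≡ 1#
  α^N≡1 with Finₚ.pigeonhole (ℕₚ.n<1+n q) (Inverse.to enumeration ∘ f)
    where
    f : Fin (suc q) → Carrier
    f Fin.zero    = 0#
    f (Fin.suc i) = α ^ toℕ i
  ... | Fin.zero , Fin.suc j , _ , eq =
    contradiction (sym (Injection.injective (↔⇒↣ enumeration) eq)) (α^-≢0 (toℕ j))
  ... | Fin.suc i , Fin.suc j , i<j , eq = subst (λ n → α ^ n ≡ 1#) (ℕₚ.≤-antisym d≤N N≤d) αᵈ≡1
    where
    i<j′ : toℕ i < toℕ j
    i<j′ = ℕ.s<s⁻¹ i<j
    d : ℕ
    d = toℕ j ∸ toℕ i
    αᵈ≡1 : α ^ d ≡ 1#
    αᵈ≡1 = x^m≡x^[m+d]⇒x^d≡1 α≢0 (toℕ i) d (trans (Injection.injective (↔⇒↣ enumeration) eq)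
      (cong (α ^_) (sym (ℕₚ.m+[n∸m]≡n (ℕₚ.<⇒≤ i<j′)))))
    N≤d : N ≤ d
    N≤d = α^d≡1⇒N≤d d {{ℕ.>-nonZero (ℕₚ.m<n⇒0<n∸m i<j′)}} αᵈ≡1
    d≤N : d ≤ N
    d≤N = ℕₚ.≤-trans (ℕₚ.m∸n≤m (toℕ j) (toℕ i)) (ℕ.s≤s⁻¹ (subst (toℕ j <_) q≡1+52k (Finₚ.toℕ<n j)))

  α^d≡1⇒N∣d : ∀ d → α ^ d ≡ 1# → N ∣ d
  α^d≡1⇒N∣d d αᵈ≡1 = m%n≡0⇒n∣m d N (r≡0 (d % N) (m%n<n d N) (trans (sym (x^d≡1⇒x^n≡x^[n%d] N α^N≡1 d)) αᵈ≡1))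
    where
    r≡0 : ∀ r → r < N → α ^ r ≡ 1# → r ≡ 0
    r≡0 zero _ _ = refl
    r≡0 (suc r) r<N αʳ≡1 = contradiction (α^d≡1⇒N≤d (suc r) αʳ≡1) (ℕₚ.<⇒≱ r<N)

  -- Exponents of equal powers differ by a multiple of `N`, and `N` is even; so the character can be
  -- read off from any exponent.
  parity-mono-wd : ∀ {m n} → m ≤ n → α ^ m ≡ α ^ n → parity n ≡ parity m
  parity-mono-wd {m} {n} m≤n eq with α^d≡1⇒N∣d (n ∸ m) (x^m≡x^[m+d]⇒x^d≡1 α≢0 m (n ∸ m)
                                       (trans eq (cong (α ^_) (sym (ℕₚ.m+[n∸m]≡n m≤n)))))
  ... | divides c d≡cN = begin
    parity n                                        ≡⟨ cong parity (sym (ℕₚ.m+[n∸m]≡n m≤n)) ⟩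
    parity (m ℕ.+ (n ∸ m))                          ≡⟨ parity-+ m (n ∸ m) ⟩
    parity m Sign.* parity (n ∸ m)                  ≡⟨ cong (λ z → parity m Sign.* parity z) d≡2e ⟩
    parity m Sign.* parity (c ℕ.* (k ℕ.* 26) ℕ.* 2) ≡⟨ cong (parity m Sign.*_) (parity-*2 (c ℕ.* (k ℕ.* 26))) ⟩
    parity m Sign.* Sign.+                          ≡⟨ Signₚ.*-identityʳ _ ⟩
    parity m                                        ∎
    where
    open ≡-Reasoning
    d≡2e : n ∸ m ≡ c ℕ.* (k ℕ.* 26) ℕ.* 2
    d≡2e = trans d≡cN (trans (cong (c ℕ.*_) (sym (ℕₚ.*-assoc k 26 2))) (sym (ℕₚ.*-assoc c (k ℕ.* 26) 2)))

  parity-wd : ∀ {m n} → α ^ m ≡ α ^ n → parity m ≡ parity n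
  parity-wd {m} {n} eq with ℕₚ.≤-total m n
  ... | inj₁ m≤n = sym (parity-mono-wd m≤n eq)
  ... | inj₂ n≤m = parity-mono-wd n≤m (sym eq)

  -- The junk value is χ 0 = +.
  χ : Carrier → Sign
  χ x with x ≟ 0#
  ... | yes _   = Sign.+
  ... | no  x≢0 = parity (proj₁ (generates x x≢0))

  χ-α^ : ∀ n → χ (α ^ n) ≡ parity n
  χ-α^ n with (α ^ n) ≟ 0#
  ... | yes αⁿ≡0 = contradiction αⁿ≡0 (α^-≢0 n)
  ... | no  αⁿ≢0 = parity-wd {proj₁ (generates (α ^ n) αⁿ≢0)} {n} (proj₂ (generates (α ^ n) αⁿ≢0))

  χ-* : ∀ {x y} → x ≢ 0# → y ≢ 0# → χ (x * y) ≡ χ x Sign.* χ y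
  χ-* {x} {y} x≢0 y≢0 with generates x x≢0 | generates y y≢0
  ... | m , refl | n , refl = begin
    χ (α ^ m * α ^ n)                ≡⟨ cong χ (sym (^-+ α m n)) ⟩
    χ (α ^ (m ℕ.+ n))                ≡⟨ χ-α^ (m ℕ.+ n) ⟩
    parity (m ℕ.+ n)                 ≡⟨ parity-+ m n ⟩
    parity m Sign.* parity n         ≡⟨ sym (cong₂ Sign._*_ (χ-α^ m) (χ-α^ n)) ⟩
    χ (α ^ m) Sign.* χ (α ^ n)       ∎
    where open ≡-Reasoning

  χ-square : ∀ {x} → x ≢ 0# → χ (x * x) ≡ Sign.+
  χ-square {x} x≢0 = trans (χ-* x≢0 x≢0) (Signₚ.s*s≡+ (χ x))

  χ≡+⇒square : ∀ {x} → x ≢ 0# → χ x ≡ Sign.+ → IsSquare F x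
  χ≡+⇒square x≢0 χ≡+ with generates _ x≢0
  ... | n , refl with parity≡+⇒even n (trans (sym (χ-α^ n)) χ≡+)
  ...   | m , refl = α ^ m , sym (^-+ α m m)

  square⇒χ≡+ : ∀ {x} → x ≢ 0# → IsSquare F x → χ x ≡ Sign.+
  square⇒χ≡+ x≢0 (y , refl) = χ-square (*-≢0ˡ x≢0)

  χ-ChiIs : ∀ {x} → x ≢ 0# → ChiIs F x (χ x)
  χ-ChiIs {x} x≢0 with χ x in eq
  ... | Sign.+ = x≢0 , χ≡+⇒square x≢0 eq
  ... | Sign.- = x≢0 , λ sq → case (trans (sym eq) (square⇒χ≡+ x≢0 sq)) of λ ()

  ChiIs⇒χ≡ : ∀ {x} s → ChiIs F x s → χ x ≡ s
  ChiIs⇒χ≡ Sign.+ (x≢0 , sq) = square⇒χ≡+ x≢0 sq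
  ChiIs⇒χ≡ {x} Sign.- (x≢0 , ¬sq) with χ x in eq
  ... | Sign.- = refl
  ... | Sign.+ = contradiction (χ≡+⇒square x≢0 eq) ¬sq

  -- A square root of 1, different from 1 by the minimality of `N`.
  α^[26k]≡-1 : α ^ (k ℕ.* 26) ≡ - 1#
  α^[26k]≡-1 = x-y≡0⇒x≡y (trans (solve 1 (λ x → x :- :- con (+ 1) := x :+ con (+ 1)) refl z) z+1≡0)
    where
    z : Carrier
    z = α ^ (k ℕ.* 26)
    z≢1 : z ≢ 1#
    z≢1 z≡1 = ℕₚ.<⇒≱ (ℕₚ.*-monoʳ-< k {26} {52} (ℕₚ.<ᵇ⇒< 26 52 _))
      (α^d≡1⇒N≤d (k ℕ.* 26) {{ℕₚ.m*n≢0 k 26}} z≡1)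
    z²≡1 : z * z ≡ 1#
    z²≡1 = begin
      z * z                         ≡⟨ sym (^-+ α (k ℕ.* 26) (k ℕ.* 26)) ⟩
      α ^ (k ℕ.* 26 ℕ.+ k ℕ.* 26)   ≡⟨ cong (α ^_) (sym (ℕₚ.*-distribˡ-+ k 26 26)) ⟩
      α ^ (k ℕ.* 52)                ≡⟨ α^N≡1 ⟩
      1#                            ∎
      where open ≡-Reasoning
    z+1≡0 : z + 1# ≡ 0#
    z+1≡0 = x*y≡0⇒y≡0 (z≢1 ∘ x-y≡0⇒x≡y)
      (trans (solve 1 (λ z → (z :- con (+ 1)) :* (z :+ con (+ 1)) := z :* z :- con (+ 1)) refl z) (x≡y⇒x-y≡0 z²≡1))

  -- Here 4 ∣ q - 1 enters: the exponent `k * 26` of -1 is even.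
  χ-[-1] : χ (- 1#) ≡ Sign.+
  χ-[-1] = begin
    χ (- 1#)                 ≡⟨ cong χ (sym α^[26k]≡-1) ⟩
    χ (α ^ (k ℕ.* 26))       ≡⟨ χ-α^ (k ℕ.* 26) ⟩
    parity (k ℕ.* 26)        ≡⟨ cong parity (sym (ℕₚ.*-assoc k 13 2)) ⟩
    parity (k ℕ.* 13 ℕ.* 2)  ≡⟨ parity-*2 (k ℕ.* 13) ⟩
    Sign.+                   ∎
    where open ≡-Reasoning

  χ-neg : ∀ {x} → x ≢ 0# → χ (- x) ≡ χ x
  χ-neg {x} x≢0 = begin
    χ (- x)                  ≡⟨ cong χ (solve 1 (λ x → :- x := :- con (+ 1) :* x) refl x) ⟩
    χ (- 1# * x)             ≡⟨ χ-* -1≢0 x≢0 ⟩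
    χ (- 1#) Sign.* χ x      ≡⟨ cong (Sign._* χ x) χ-[-1] ⟩
    χ x                      ∎
    where
    open ≡-Reasoning
    -1≢0 : - 1# ≢ 0#
    -1≢0 = subst (_≢ 0#) α^[26k]≡-1 (α^-≢0 (k ℕ.* 26))

  -- Cyclic subgroups of the multiplicative group

  module CyclicSubgroup (h K : ℕ) .{{_ : NonZero K}} (h*K≡N : h ℕ.* K ≡ N) where

    γ : Carrier
    γ = α ^ h

    γ≢0 : γ ≢ 0#
    γ≢0 = α^-≢0 h

    γ^-≢0 : ∀ n → γ ^ n ≢ 0#
    γ^-≢0 = ^-≢0 γ≢0

    γ^K≡1 : γ ^ K ≡ 1#
    γ^K≡1 = trans (sym (^-* α h K)) (trans (cong (α ^_) h*K≡N) α^N≡1)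

    private instance
      h≢0 : NonZero h
      h≢0 = ℕₚ.m*n≢0⇒m≢0 h {K} {{subst NonZero (sym h*K≡N) N≢0}}

    γ^n≡1⇒K∣n : ∀ n → γ ^ n ≡ 1# → K ∣ n
    γ^n≡1⇒K∣n n γⁿ≡1 = *-cancelˡ-∣ h (subst (_∣ h ℕ.* n) (sym h*K≡N) (α^d≡1⇒N∣d (h ℕ.* n) (trans (^-* α h n) γⁿ≡1)))

    γ^n≢1 : ∀ {n} → 0 < n → n < K → γ ^ n ≢ 1#
    γ^n≢1 {n} 0<n n<K γⁿ≡1 = ℕₚ.<⇒≱ n<K (∣⇒≤ {{ℕ.>-nonZero 0<n}} (γ^n≡1⇒K∣n n γⁿ≡1))

    γ^-% : ∀ n → γ ^ n ≡ γ ^ (n % K)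
    γ^-% = x^d≡1⇒x^n≡x^[n%d] K γ^K≡1

    γ^-injective-≤ : ∀ {i j} → i ≤ j → j < K → γ ^ i ≡ γ ^ j → i ≡ j
    γ^-injective-≤ {i} {j} i≤j j<K eq with ℕₚ.m≤n⇒m<n∨m≡n i≤j
    ... | inj₂ i≡j = i≡j
    ... | inj₁ i<j = contradiction
      (x^m≡x^[m+d]⇒x^d≡1 γ≢0 i (j ∸ i) (trans eq (cong (γ ^_) (sym (ℕₚ.m+[n∸m]≡n i≤j)))))
      (γ^n≢1 (ℕₚ.m<n⇒0<n∸m i<j) (ℕₚ.≤-<-trans (ℕₚ.m∸n≤m j i) j<K))

    γ^-injective : ∀ {i j} → i < K → j < K → γ ^ i ≡ γ ^ j → i ≡ j
    γ^-injective {i} {j} i<K j<K eq with ℕₚ.≤-total i j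
    ... | inj₁ i≤j = γ^-injective-≤ i≤j j<K eq
    ... | inj₂ j≤i = sym (γ^-injective-≤ j≤i i<K (sym eq))

    ⟨γ⟩ : Subset F
    ⟨γ⟩ x = ∃ λ n → γ ^ n ≡ x

    powers : List Carrier
    powers = map (γ ^_) (upTo K)

    length-powers : length powers ≡ K
    length-powers = trans (length-map (γ ^_) (upTo K)) (length-upTo K)

    powers-unique : Unique powers
    powers-unique = AllPairsₚ.map⁺ (AllPairsₚ.applyUpTo⁺₁ (λ i → i) K
      λ i<j j<K γⁱ≡γʲ → ℕₚ.<⇒≢ i<j (γ^-injective (ℕₚ.<-trans i<j j<K) j<K γⁱ≡γʲ))

    ⟨γ⟩⇒∈powers : ∀ {x} → ⟨γ⟩ x → x ∈ powers
    ⟨γ⟩⇒∈powers (n , refl) = subst (_∈ powers) (sym (γ^-% n)) (∈-map⁺ (γ ^_) (∈-upTo⁺ (m%n<n n K)))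

    ∈powers⇒⟨γ⟩ : ∀ {x} → x ∈ powers → ⟨γ⟩ x
    ∈powers⇒⟨γ⟩ x∈ = let n , _ , x≡γⁿ = ∈-map⁻ (γ ^_) x∈ in n , sym x≡γⁿ

    -- Exponents are natural numbers, so n (K - 1) stands in for -n modulo K.
    γ^n*γ^[n*[K∸1]]≡1 : ∀ n → γ ^ n * γ ^ (n ℕ.* (K ∸ 1)) ≡ 1#
    γ^n*γ^[n*[K∸1]]≡1 n = begin
      γ ^ n * γ ^ (n ℕ.* (K ∸ 1))   ≡⟨ sym (^-+ γ n _) ⟩
      γ ^ (n ℕ.+ n ℕ.* (K ∸ 1))     ≡⟨ cong (γ ^_) (sym (ℕₚ.*-suc n (K ∸ 1))) ⟩
      γ ^ (n ℕ.* suc (K ∸ 1))       ≡⟨ cong (λ m → γ ^ (n ℕ.* m)) (ℕₚ.suc-pred K) ⟩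
      γ ^ (n ℕ.* K)                 ≡⟨ cong (γ ^_) (ℕₚ.*-comm n K) ⟩
      γ ^ (K ℕ.* n)                 ≡⟨ ^-* γ K n ⟩
      (γ ^ K) ^ n                   ≡⟨ cong (_^ n) γ^K≡1 ⟩
      1# ^ n                        ≡⟨ 1^ n ⟩
      1#                            ∎
      where open ≡-Reasoning

    ⟨γ⟩-isSubgroup : IsSubgroupOfOrder F ⟨γ⟩ K
    ⟨γ⟩-isSubgroup = (λ { x (n , refl) → γ^-≢0 n }) , (0 , refl)
      , (λ { x y (m , refl) (n , refl) → m ℕ.+ n , ^-+ γ m n })
      , (λ { x (n , refl) → n ℕ.* (K ∸ 1) ,
             *-cancelˡ (γ^-≢0 n) (trans (γ^n*γ^[n*[K∸1]]≡1 n) (sym (⁻¹-inverse _ (γ^-≢0 n)))) })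
      , powers , powers-unique , length-powers , λ x → mk⇔ ⟨γ⟩⇒∈powers ∈powers⇒⟨γ⟩

    -- Uniqueness of the subgroup of order `K`

    module _ {B : Subset F} (B-isSubgroup : IsSubgroupOfOrder F B K) where

      private
        B-≢0 = proj₁ B-isSubgroup
        B-* = proj₁ (proj₂ (proj₂ B-isSubgroup))
        B-⁻¹ = proj₁ (proj₂ (proj₂ (proj₂ B-isSubgroup)))
        xs = proj₁ (proj₂ (proj₂ (proj₂ (proj₂ B-isSubgroup))))
        xs-unique = proj₁ (proj₂ (proj₂ (proj₂ (proj₂ (proj₂ B-isSubgroup)))))
        length-xs = proj₁ (proj₂ (proj₂ (proj₂ (proj₂ (proj₂ (proj₂ B-isSubgroup))))))
        B⇔∈xs = proj₂ (proj₂ (proj₂ (proj₂ (proj₂ (proj₂ (proj₂ B-isSubgroup))))))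

        ∏ : List Carrier → Carrier
        ∏ = foldr _*_ 1#

        ∏-map-* : ∀ x ys → ∏ (map (x *_) ys) ≡ x ^ length ys * ∏ ys
        ∏-map-* x [] = sym (*-identityˡ 1#)
        ∏-map-* x (y ∷ ys) = trans (cong (x * y *_) (∏-map-* x ys))
          (solve 4 (λ x y p q → x :* y :* (p :* q) := x :* p :* (y :* q)) refl x y (x ^ length ys) (∏ ys))

        ∏-≢0 : ∀ {ys} → All (_≢ 0#) ys → ∏ ys ≢ 0#
        ∏-≢0 [] = 1≢0
        ∏-≢0 (y≢0 ∷ ys≢0) = *-≢0 y≢0 (∏-≢0 ys≢0)

        x*-↭ : ∀ {x} → B x → map (x *_) xs ↭ xs
        x*-↭ {x} Bx = ∼bag⇒↭ (unique∧set⇒bag (Uniqueₚ.map⁺ (*-cancelˡ (B-≢0 x Bx)) xs-unique) xs-unique (mk⇔ to from))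
          where
          to : ∀ {y} → y ∈ map (x *_) xs → y ∈ xs
          to y∈ with ∈-map⁻ (x *_) y∈
          ... | z , z∈ , refl = Equivalence.to (B⇔∈xs _) (B-* x z Bx (Equivalence.from (B⇔∈xs z) z∈))
          from : ∀ {y} → y ∈ xs → y ∈ map (x *_) xs
          from {y} y∈ = subst (_∈ map (x *_) xs) x*x⁻¹y≡y
            (∈-map⁺ (x *_) (Equivalence.to (B⇔∈xs _) (B-* _ _ (B-⁻¹ x Bx) (Equivalence.from (B⇔∈xs y) y∈))))
            where
            x*x⁻¹y≡y : x * (x ⁻¹ * y) ≡ y
            x*x⁻¹y≡y = trans (sym (*-assoc _ _ _)) (trans (cong (_* y) (⁻¹-inverse x (B-≢0 x Bx))) (*-identityˡ y))

        -- Lagrange for an abelian group: multiplication by x permutes B, so the product of all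
        -- elements of B equals itself times x^K.
        x^K≡1 : ∀ {x} → B x → x ^ K ≡ 1#
        x^K≡1 {x} Bx = *-cancelˡ (∏-≢0 xs≢0) (begin
          ∏ xs * x ^ K            ≡⟨ *-comm _ _ ⟩
          x ^ K * ∏ xs            ≡⟨ cong (λ n → x ^ n * ∏ xs) (sym length-xs) ⟩
          x ^ length xs * ∏ xs    ≡⟨ sym (∏-map-* x xs) ⟩
          ∏ (map (x *_) xs)       ≡⟨ foldr-commMonoid (setoid Carrier) *-isCommutativeMonoid (↭⇒↭ₛ (x*-↭ Bx)) ⟩
          ∏ xs                    ≡⟨ sym (*-identityʳ _) ⟩
          ∏ xs * 1#               ∎)
          where
          open ≡-Reasoning
          xs≢0 : All (_≢ 0#) xs
          xs≢0 = All.tabulate λ y∈ → B-≢0 _ (Equivalence.from (B⇔∈xs _) y∈)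

        -- For x = αⁿ, x^K = 1 gives h K ∣ n K, hence h ∣ n.
        B⊆⟨γ⟩ : ∀ {x} → B x → ⟨γ⟩ x
        B⊆⟨γ⟩ {x} Bx with generates x (B-≢0 x Bx)
        ... | n , refl with *-cancelʳ-∣ {h} {n} K (subst (_∣ n ℕ.* K) (sym h*K≡N)
                              (α^d≡1⇒N∣d (n ℕ.* K) (trans (^-* α n K) (x^K≡1 Bx))))
        ...   | divides m refl = m , trans (sym (^-* α h m)) (cong (α ^_) (ℕₚ.*-comm h m))

        -- By size: an element of ⟨γ⟩ outside B would put K + 1 distinct elements into ⟨γ⟩.
        ⟨γ⟩⊆B : ∀ {x} → ⟨γ⟩ x → B x
        ⟨γ⟩⊆B {x} γx with Any.any? (x ≟_) xs
        ... | yes x∈ = Equivalence.from (B⇔∈xs x) x∈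
        ... | no  x∉ = contradiction
          (unique-⊆⇒length≤ {xs = x ∷ xs} (¬Any⇒All¬ xs x∉ ∷ xs-unique) λ where
            (here refl) → ⟨γ⟩⇒∈powers γx
            (there y∈) → ⟨γ⟩⇒∈powers (B⊆⟨γ⟩ (Equivalence.from (B⇔∈xs _) y∈)))
          (ℕₚ.<⇒≱ (ℕ.s≤s (ℕₚ.≤-reflexive (trans length-powers (sym length-xs)))))

      B⇔⟨γ⟩ : ∀ {x} → B x ⇔ ⟨γ⟩ x
      B⇔⟨γ⟩ = mk⇔ B⊆⟨γ⟩ ⟨γ⟩⊆B

-- The projective line

-- Points are handled through the homogeneous coordinates (X : Y), with ∞ = (1 : 0) and z = (z : 1).
module ProjectiveLine {q : ℕ} (F : FiniteField q) where
  open FiniteField F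
  open FieldProperties F

  X Y : Point F → Carrier
  X nothing  = 1#
  X (just x) = x
  Y nothing  = 0#
  Y (just _) = 1#

  D : Point F → Point F → Carrier
  D p r = X p * Y r - X r * Y p

  D≡0⇒≡ : ∀ p r → D p r ≡ 0# → p ≡ r
  D≡0⇒≡ nothing nothing _ = refl
  D≡0⇒≡ nothing (just y) D≡0 = contradiction
    (trans (solve 1 (λ y → con (+ 1) := con (+ 1) :* con (+ 1) :- y :* con (+ 0)) refl y) D≡0) 1≢0
  D≡0⇒≡ (just x) nothing D≡0 = contradiction
    (trans (solve 1 (λ x → con (+ 1) := :- (x :* con (+ 0) :- con (+ 1) :* con (+ 1))) refl x)
      (trans (cong -_ D≡0) (solve 0 (:- con (+ 0) := con (+ 0)) refl))) 1≢0
  D≡0⇒≡ (just x) (just y) D≡0 = cong just (x-y≡0⇒x≡y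
    (trans (solve 2 (λ x y → x :- y := x :* con (+ 1) :- y :* con (+ 1)) refl x y) D≡0))

  D-≢0 : ∀ {p r} → p ≢ r → D p r ≢ 0#
  D-≢0 p≢r D≡0 = p≢r (D≡0⇒≡ _ _ D≡0)

  -- The graph of `act` up to a scalar on homogeneous coordinates. It has neither division nor a
  -- special case for ∞, so statements about `act` become polynomial identities.
  record Sends (g : PSL2 F) (p r : Point F) : Set where
    constructor sends
    open PSL2 g
    field
      scale   : Carrier
      scale≢0 : scale ≢ 0#
      X-eq    : a * X p + b * Y p ≡ scale * X r
      Y-eq    : c * X p + d * Y p ≡ scale * Y r

  private
    det-≢0 : ∀ a b c d z → a * d - b * c ≡ 1# → c * z + d ≡ 0# → a * z + b ≢ 0#
    det-≢0 a b c d z det cz+d≡0 az+b≡0 = 1≢0 (begin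
      1#                                    ≡⟨ sym det ⟩
      a * d - b * c                         ≡⟨ solve 5 (λ a b c d z → a :* d :- b :* c :=
                                                  a :* (c :* z :+ d) :- c :* (a :* z :+ b)) refl a b c d z ⟩
      a * (c * z + d) - c * (a * z + b)     ≡⟨ cong₂ (λ u v → a * u - c * v) cz+d≡0 az+b≡0 ⟩
      a * 0# - c * 0#                       ≡⟨ solve 2 (λ a c → a :* con (+ 0) :- c :* con (+ 0) := con (+ 0)) refl a c ⟩
      0#                                    ∎)
      where open ≡-Reasoning

    det-≢0-∞ : ∀ a b c d → a * d - b * c ≡ 1# → c ≡ 0# → a ≢ 0#
    det-≢0-∞ a b c d det c≡0 a≡0 = 1≢0 (trans (sym det) (trans (cong₂ (λ u v → u * d - b * v) a≡0 c≡0)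
      (solve 2 (λ b d → con (+ 0) :* d :- b :* con (+ 0) := con (+ 0)) refl b d)))

    *-⁻¹-assoc : ∀ {x} y → x ≢ 0# → x * (y * x ⁻¹) ≡ y
    *-⁻¹-assoc {x} y x≢0 = trans (solve 3 (λ x y i → x :* (y :* i) := x :* i :* y) refl x y (x ⁻¹))
      (trans (cong (_* y) (⁻¹-inverse x x≢0)) (*-identityˡ y))

  act-sends : ∀ g p → Sends g p (act F g p)
  act-sends (mat a b c d det) nothing with c ≟ 0#
  ... | yes c≡0 = sends a (det-≢0-∞ a b c d det c≡0)
    (solve 2 (λ a b → a :* con (+ 1) :+ b :* con (+ 0) := a :* con (+ 1)) refl a b)
    (trans (solve 2 (λ c d → c :* con (+ 1) :+ d :* con (+ 0) := c) refl c d) (trans c≡0 (sym (zeroʳ a))))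
  ... | no c≢0 = sends c c≢0
    (trans (solve 2 (λ a b → a :* con (+ 1) :+ b :* con (+ 0) := a) refl a b) (sym (*-⁻¹-assoc a c≢0)))
    (solve 2 (λ c d → c :* con (+ 1) :+ d :* con (+ 0) := c :* con (+ 1)) refl c d)
  act-sends (mat a b c d det) (just z) with (c * z + d) ≟ 0#
  ... | yes cz+d≡0 = sends (a * z + b) (det-≢0 a b c d z det cz+d≡0)
    (solve 3 (λ a b z → a :* z :+ b :* con (+ 1) := (a :* z :+ b) :* con (+ 1)) refl a b z)
    (trans (cong (λ e → c * z + e) (*-identityʳ d)) (trans cz+d≡0 (sym (zeroʳ _))))
  ... | no cz+d≢0 = sends (c * z + d) cz+d≢0
    (trans (cong (λ e → a * z + e) (*-identityʳ b)) (sym (*-⁻¹-assoc _ cz+d≢0)))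
    (solve 3 (λ c d z → c :* z :+ d :* con (+ 1) := (c :* z :+ d) :* con (+ 1)) refl c d z)

  -- The coordinates of both images are proportional to one vector, so their determinant vanishes.
  sends-functional : ∀ {g p r r′} → Sends g p r → Sends g p r′ → r ≡ r′
  sends-functional {r = r} {r′} (sends s s≢0 Xs Ys) (sends t t≢0 Xt Yt) = D≡0⇒≡ r r′ (x*y≡0⇒y≡0 (*-≢0 s≢0 t≢0) (begin
    s * t * (X r * Y r′ - X r′ * Y r)
      ≡⟨ solve 6 (λ s t x y x′ y′ → s :* t :* (x :* y′ :- x′ :* y) := (s :* x) :* (t :* y′) :- (t :* x′) :* (s :* y))
           refl s t (X r) (Y r) (X r′) (Y r′) ⟩
    s * X r * (t * Y r′) - t * X r′ * (s * Y r)
      ≡⟨ cong₂ (λ u v → u * (t * Y r′) - v * (s * Y r)) (trans (sym Xs) Xt) refl ⟩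
    t * X r′ * (t * Y r′) - t * X r′ * (s * Y r)
      ≡⟨ cong (λ u → t * X r′ * (t * Y r′) - t * X r′ * u) (trans (sym Ys) Yt) ⟩
    t * X r′ * (t * Y r′) - t * X r′ * (t * Y r′)
      ≡⟨ -‿inverseʳ _ ⟩
    0# ∎))
    where open ≡-Reasoning

  sends⇒act≡ : ∀ {g p r} → Sends g p r → act F g p ≡ r
  sends⇒act≡ {g} {p} s = sends-functional (act-sends g p) s

  infixr 9 _∙_

  -- Unfolding products to matrix entries makes conversion checking blow up.
  abstract
    _∙_ : PSL2 F → PSL2 F → PSL2 F
    mat a b c d det ∙ mat a′ b′ c′ d′ det′ =
      mat (a * a′ + b * c′) (a * b′ + b * d′) (c * a′ + d * c′) (c * b′ + d * d′)
        (trans (solve 8 (λ a b c d a′ b′ c′ d′ →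
            (a :* a′ :+ b :* c′) :* (c :* b′ :+ d :* d′) :- (a :* b′ :+ b :* d′) :* (c :* a′ :+ d :* c′)
              := (a :* d :- b :* c) :* (a′ :* d′ :- b′ :* c′)) refl a b c d a′ b′ c′ d′)
          (trans (cong₂ _*_ det det′) (*-identityˡ 1#)))

    inv : PSL2 F → PSL2 F
    inv (mat a b c d det) = mat d (- b) (- c) a
      (trans (solve 4 (λ a b c d → d :* a :- (:- b) :* (:- c) := a :* d :- b :* c) refl a b c d) det)

    ι : PSL2 F
    ι = mat 1# 0# 0# 1# (solve 0 (con (+ 1) :* con (+ 1) :- con (+ 0) :* con (+ 0) := con (+ 1)) refl)

    act-ι : ∀ p → act F ι p ≡ p
    act-ι p = sends⇒act≡ {ι} {p} (sends 1# 1≢0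
      (solve 2 (λ x y → con (+ 1) :* x :+ con (+ 0) :* y := con (+ 1) :* x) refl (X p) (Y p))
      (solve 2 (λ x y → con (+ 0) :* x :+ con (+ 1) :* y := con (+ 1) :* y) refl (X p) (Y p)))

    sends-∙ : ∀ {g h p r t} → Sends h p r → Sends g r t → Sends (g ∙ h) p t
    sends-∙ {mat a b c d _} {mat a′ b′ c′ d′ _} {p} {r} {t} (sends s s≢0 Xs Ys) (sends s′ s′≢0 Xs′ Ys′) =
      sends (s * s′) (*-≢0 s≢0 s′≢0) (row a b (X t) Xs′) (row c d (Y t) Ys′)
      where
      open ≡-Reasoning
      row : ∀ e f w → e * X r + f * Y r ≡ s′ * w →
        (e * a′ + f * c′) * X p + (e * b′ + f * d′) * Y p ≡ s * s′ * w
      row e f w eq = begin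
        (e * a′ + f * c′) * X p + (e * b′ + f * d′) * Y p
          ≡⟨ solve 8 (λ e f a b c d x y → (e :* a :+ f :* c) :* x :+ (e :* b :+ f :* d) :* y
               := e :* (a :* x :+ b :* y) :+ f :* (c :* x :+ d :* y)) refl e f a′ b′ c′ d′ (X p) (Y p) ⟩
        e * (a′ * X p + b′ * Y p) + f * (c′ * X p + d′ * Y p)
          ≡⟨ cong₂ (λ u v → e * u + f * v) Xs Ys ⟩
        e * (s * X r) + f * (s * Y r)
          ≡⟨ solve 5 (λ e f s x y → e :* (s :* x) :+ f :* (s :* y) := s :* (e :* x :+ f :* y)) refl e f s (X r) (Y r) ⟩
        s * (e * X r + f * Y r)
          ≡⟨ cong (s *_) eq ⟩
        s * (s′ * w)
          ≡⟨ sym (*-assoc s s′ w) ⟩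
        s * s′ * w ∎

    act-∙ : ∀ g h p → act F (g ∙ h) p ≡ act F g (act F h p)
    act-∙ g h p = sends⇒act≡ {g ∙ h} (sends-∙ {g} {h} (act-sends h p) (act-sends g (act F h p)))

    sends-inv : ∀ {g p r} → Sends g p r → Sends (inv g) r p
    sends-inv {mat a b c d det} {p} {r} (sends s s≢0 Xs Ys) = sends (s ⁻¹) (⁻¹-≢0 s≢0)
      (*-cancelˡ s≢0 (begin
        s * (d * X r + - b * Y r)
          ≡⟨ solve 5 (λ s b d x y → s :* (d :* x :+ :- b :* y) := d :* (s :* x) :- b :* (s :* y)) refl s b d (X r) (Y r) ⟩
        d * (s * X r) - b * (s * Y r)
          ≡⟨ cong₂ (λ u v → d * u - b * v) (sym Xs) (sym Ys) ⟩
        d * (a * X p + b * Y p) - b * (c * X p + d * Y p)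
          ≡⟨ solve 6 (λ a b c d x y → d :* (a :* x :+ b :* y) :- b :* (c :* x :+ d :* y) := (a :* d :- b :* c) :* x)
               refl a b c d (X p) (Y p) ⟩
        (a * d - b * c) * X p
          ≡⟨ finish (X p) ⟩
        s * (s ⁻¹ * X p) ∎))
      (*-cancelˡ s≢0 (begin
        s * (- c * X r + a * Y r)
          ≡⟨ solve 5 (λ s a c x y → s :* (:- c :* x :+ a :* y) := a :* (s :* y) :- c :* (s :* x)) refl s a c (X r) (Y r) ⟩
        a * (s * Y r) - c * (s * X r)
          ≡⟨ cong₂ (λ u v → a * v - c * u) (sym Xs) (sym Ys) ⟩
        a * (c * X p + d * Y p) - c * (a * X p + b * Y p)
          ≡⟨ solve 6 (λ a b c d x y → a :* (c :* x :+ d :* y) :- c :* (a :* x :+ b :* y) := (a :* d :- b :* c) :* y)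
               refl a b c d (X p) (Y p) ⟩
        (a * d - b * c) * Y p
          ≡⟨ finish (Y p) ⟩
        s * (s ⁻¹ * Y p) ∎))
      where
      open ≡-Reasoning
      finish : ∀ w → (a * d - b * c) * w ≡ s * (s ⁻¹ * w)
      finish w = trans (cong (_* w) (trans det (sym (⁻¹-inverse s s≢0)))) (*-assoc _ _ _)

  act-inv : ∀ g {p r} → act F g p ≡ r → act F (inv g) r ≡ p
  act-inv g {p} refl = sends⇒act≡ {inv g} (sends-inv {g} (act-sends g p))

  act-inv-act : ∀ g p → act F (inv g) (act F g p) ≡ p
  act-inv-act g p = act-inv g refl

  act-injective : ∀ g {p r} → act F g p ≡ act F g r → p ≡ r
  act-injective g {p} {r} eq = trans (sym (act-inv g eq)) (act-inv g refl)

  act-act-inv : ∀ g p → act F g (act F (inv g) p) ≡ p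
  act-act-inv g p = act-injective (inv g) (act-inv g refl)

  -- Multiplicativity of the determinant: `g` has determinant 1, and each image column is its scale
  -- times the coordinates of the image point.
  D-act : ∀ g p r → D p r ≡
    Sends.scale (act-sends g p) * Sends.scale (act-sends g r) * D (act F g p) (act F g r)
  D-act g@(mat a b c d det) p r with act-sends g p | act-sends g r
  ... | sends s _ Xs Ys | sends t _ Xt Yt = begin
    D p r
      ≡⟨ sym (trans (cong (_* D p r) det) (*-identityˡ _)) ⟩
    (a * d - b * c) * D p r
      ≡⟨ solve 8 (λ a b c d x y x′ y′ → (a :* d :- b :* c) :* (x :* y′ :- x′ :* y)
           := (a :* x :+ b :* y) :* (c :* x′ :+ d :* y′) :- (a :* x′ :+ b :* y′) :* (c :* x :+ d :* y))
           refl a b c d (X p) (Y p) (X r) (Y r) ⟩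
    (a * X p + b * Y p) * (c * X r + d * Y r) - (a * X r + b * Y r) * (c * X p + d * Y p)
      ≡⟨ cong₂ _-_ (cong₂ _*_ Xs Yt) (cong₂ _*_ Xt Ys) ⟩
    s * X p′ * (t * Y r′) - t * X r′ * (s * Y p′)
      ≡⟨ solve 6 (λ s t x y x′ y′ → s :* x :* (t :* y′) :- t :* x′ :* (s :* y) := s :* t :* (x :* y′ :- x′ :* y))
           refl s t (X p′) (Y p′) (X r′) (Y r′) ⟩
    s * t * D p′ r′ ∎
    where
    open ≡-Reasoning
    p′ = act F g p
    r′ = act F g r

  Triple : Set
  Triple = Point F × Point F × Point F

  Distinct : Triple → Set
  Distinct (p , r , t) = p ≢ r × p ≢ t × r ≢ t

  act³ : PSL2 F → Triple → Triple
  act³ g (p , r , t) = act F g p , act F g r , act F g t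

  triple≡ : ∀ {p p′ r r′ t t′ : Point F} → p ≡ p′ → r ≡ r′ → t ≡ t′ → (p , r , t) ≡ (p′ , r′ , t′)
  triple≡ refl refl refl = refl

  act³-∙ : ∀ g h T → act³ (g ∙ h) T ≡ act³ g (act³ h T)
  act³-∙ g h (p , r , t) = triple≡ (act-∙ g h p) (act-∙ g h r) (act-∙ g h t)

  act³-inv-act³ : ∀ g T → act³ (inv g) (act³ g T) ≡ T
  act³-inv-act³ g (p , r , t) = triple≡ (act-inv-act g p) (act-inv-act g r) (act-inv-act g t)

  act³-act³-inv : ∀ g T → act³ g (act³ (inv g) T) ≡ T
  act³-act³-inv g (p , r , t) = triple≡ (act-act-inv g p) (act-act-inv g r) (act-act-inv g t)

  act³-distinct : ∀ g {T} → Distinct T → Distinct (act³ g T)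
  act³-distinct g (p≢r , p≢t , r≢t) = p≢r ∘ act-injective g , p≢t ∘ act-injective g , r≢t ∘ act-injective g

  -- Equality in PSL(2,q). Equality of matrices is too fine, since M and -M act alike.
  Agree : PSL2 F → PSL2 F → Set
  Agree g h = ∀ p → act F g p ≡ act F h p

  0P : Point F
  0P = just 0#

  -- Fixing ∞ and 0 makes the matrix diagonal; fixing u ≠ 0 as well makes it scalar.
  fixes-standard⇒identity : ∀ g {u} → u ≢ 0# → act³ g (nothing , 0P , just u) ≡ (nothing , 0P , just u) →
    ∀ p → act F g p ≡ p
  fixes-standard⇒identity g@(mat a b c d det) {u} u≢0 fix p
    with subst (Sends g nothing) (cong proj₁ fix) (act-sends g nothing)
       | subst (Sends g 0P) (cong (proj₁ ∘ proj₂) fix) (act-sends g 0P)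
       | subst (Sends g (just u)) (cong (proj₂ ∘ proj₂) fix) (act-sends g (just u))
  ... | sends s₁ _ _ Y₁ | sends s₂ _ X₂ _ | sends s₃ s₃≢0 X₃ Y₃ = sends⇒act≡ {g} {p} (sends d d≢0
      (trans (cong₂ (λ e f → e * X p + f * Y p) a≡d b≡0)
        (solve 3 (λ d x y → d :* x :+ con (+ 0) :* y := d :* x) refl d (X p) (Y p)))
      (trans (cong (λ e → e * X p + d * Y p) c≡0)
        (solve 3 (λ d x y → con (+ 0) :* x :+ d :* y := d :* y) refl d (X p) (Y p))))
    where
    c≡0 : c ≡ 0#
    c≡0 = trans (solve 2 (λ c d → c := c :* con (+ 1) :+ d :* con (+ 0)) refl c d) (trans Y₁ (zeroʳ s₁))
    b≡0 : b ≡ 0#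
    b≡0 = trans (solve 2 (λ a b → b := a :* con (+ 0) :+ b :* con (+ 1)) refl a b) (trans X₂ (zeroʳ s₂))
    d≡s₃ : d ≡ s₃
    d≡s₃ = trans (solve 2 (λ d u → d := con (+ 0) :* u :+ d :* con (+ 1)) refl d u)
      (trans (cong (λ e → e * u + d * 1#) (sym c≡0)) (trans Y₃ (*-identityʳ s₃)))
    d≢0 : d ≢ 0#
    d≢0 d≡0 = s₃≢0 (trans (sym d≡s₃) d≡0)
    a≡d : a ≡ d
    a≡d = *-cancelˡ u≢0 (begin
      u * a              ≡⟨ solve 2 (λ a u → u :* a := a :* u :+ con (+ 0) :* con (+ 1)) refl a u ⟩
      a * u + 0# * 1#    ≡⟨ cong (λ e → a * u + e * 1#) (sym b≡0) ⟩
      a * u + b * 1#     ≡⟨ X₃ ⟩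
      s₃ * u             ≡⟨ cong (_* u) (sym d≡s₃) ⟩
      d * u              ≡⟨ *-comm d u ⟩
      u * d              ∎)
      where open ≡-Reasoning

-- Types of triples

module TripleType {q : ℕ} (F : FiniteField q) (k : ℕ) (q≡1+52k : q ≡ suc (k ℕ.* 52))
  (α : FiniteField.Carrier F) (generates : IsPrimitiveRoot F α) where
  open FiniteField F
  open FieldProperties F
  open PrimitiveRoot F k q≡1+52k α generates
  open ProjectiveLine F

  Δ : Triple → Carrier
  Δ (p , r , t) = D p r * D r t * D p t

  Δ-≢0 : ∀ {T} → Distinct T → Δ T ≢ 0#
  Δ-≢0 (p≢r , p≢t , r≢t) = *-≢0 (*-≢0 (D-≢0 p≢r) (D-≢0 r≢t)) (D-≢0 p≢t)

  τ : Triple → Sign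
  τ T = χ (Δ T)

  -- D is multiplied by the product of the two scales, so Δ is multiplied by a square.
  τ-act³ : ∀ g T → Distinct T → τ (act³ g T) ≡ τ T
  τ-act³ g T@(p , r , t) T-distinct = sym (begin
    χ (Δ T)                                    ≡⟨ cong χ Δ≡ ⟩
    χ (s * s * Δ (act³ g T))                   ≡⟨ χ-* (*-≢0 s≢0 s≢0) (Δ-≢0 (act³-distinct g T-distinct)) ⟩
    χ (s * s) Sign.* τ (act³ g T)              ≡⟨ cong (Sign._* τ (act³ g T)) (χ-square s≢0) ⟩
    τ (act³ g T)                               ∎)
    where
    open ≡-Reasoning
    open Sends
    s₁ = scale (act-sends g p)
    s₂ = scale (act-sends g r)
    s₃ = scale (act-sends g t)
    s = s₁ * s₂ * s₃
    s≢0 : s ≢ 0#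
    s≢0 = *-≢0 (*-≢0 (scale≢0 (act-sends g p)) (scale≢0 (act-sends g r))) (scale≢0 (act-sends g t))
    Δ≡ : Δ T ≡ s * s * Δ (act³ g T)
    Δ≡ = trans (cong₂ _*_ (cong₂ _*_ (D-act g p r) (D-act g r t)) (D-act g p t))
      (solve 6 (λ s₁ s₂ s₃ d₁ d₂ d₃ → s₁ :* s₂ :* d₁ :* (s₂ :* s₃ :* d₂) :* (s₁ :* s₃ :* d₃)
          := s₁ :* s₂ :* s₃ :* (s₁ :* s₂ :* s₃) :* (d₁ :* d₂ :* d₃)) refl s₁ s₂ s₃ _ _ _)

  -- The triple (∞, 0, u) has Δ = -u and -1 is a square, so its type is χ u; α, with odd exponent 1,
  -- serves as the nonsquare.
  representative : Sign → Carrier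
  representative Sign.+ = 1#
  representative Sign.- = α

  representative-≢0 : ∀ s → representative s ≢ 0#
  representative-≢0 Sign.+ = 1≢0
  representative-≢0 Sign.- = α≢0

  χ-representative : ∀ s → χ (representative s) ≡ s
  χ-representative Sign.+ = χ-α^ 0
  χ-representative Sign.- = trans (cong χ (sym (*-identityʳ α))) (χ-α^ 1)

  standard : Sign → Triple
  standard s = nothing , 0P , just (representative s)

  standard-distinct : ∀ s → Distinct (standard s)
  standard-distinct s = (λ ()) , (λ ()) , representative-≢0 s ∘ sym ∘ just-injective

  τ-standard : ∀ s → τ (standard s) ≡ s
  τ-standard s = begin
    χ ((1# * 1# - 0# * 0#) * (0# * 1# - u * 1#) * (1# * 1# - u * 0#))
      ≡⟨ cong χ (solve 1 (λ u → (con (+ 1) :* con (+ 1) :- con (+ 0) :* con (+ 0))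
           :* (con (+ 0) :* con (+ 1) :- u :* con (+ 1))
           :* (con (+ 1) :* con (+ 1) :- u :* con (+ 0)) := :- u) refl u) ⟩
    χ (- u)     ≡⟨ χ-neg (representative-≢0 s) ⟩
    χ u         ≡⟨ χ-representative s ⟩
    s           ∎
    where
    open ≡-Reasoning
    u = representative s

  abstract
    -- The columns are l (X p , Y p) and m (X r , Y r), with l : m chosen so that u goes to t;
    -- the common factor v = 1 / y of l and m, where y² = - Δ T * u, makes the determinant 1.
    from-standard : ∀ T → Distinct T → ∃ λ g → act³ g (standard (τ T)) ≡ T
    from-standard T@(p , r , t) T-distinct@(p≢r , p≢t , r≢t) = g ,
      triple≡ (sends⇒act≡ {g} sends-∞) (sends⇒act≡ {g} sends-0) (sends⇒act≡ {g} sends-u)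
      where
      open ≡-Reasoning
      u : Carrier
      u = representative (τ T)
      u≢0 : u ≢ 0#
      u≢0 = representative-≢0 (τ T)
      w : Carrier
      w = - (Δ T * u)
      Δu≢0 : Δ T * u ≢ 0#
      Δu≢0 = *-≢0 (Δ-≢0 T-distinct) u≢0
      w≢0 : w ≢ 0#
      w≢0 = neg-≢0 Δu≢0
      χw≡+ : χ w ≡ Sign.+
      χw≡+ = begin
        χ w                                ≡⟨ χ-neg Δu≢0 ⟩
        χ (Δ T * u)                        ≡⟨ χ-* (Δ-≢0 T-distinct) u≢0 ⟩
        τ T Sign.* χ u                     ≡⟨ cong (τ T Sign.*_) (χ-representative (τ T)) ⟩
        τ T Sign.* τ T                     ≡⟨ Signₚ.s*s≡+ (τ T) ⟩
        Sign.+                             ∎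
      w-square : IsSquare F w
      w-square = χ≡+⇒square w≢0 χw≡+
      y : Carrier
      y = proj₁ w-square
      y≢0 : y ≢ 0#
      y≢0 y≡0 = w≢0 (trans (sym (proj₂ w-square)) (trans (cong (_* y) y≡0) (zeroˡ y)))
      v : Carrier
      v = y ⁻¹
      v≢0 : v ≢ 0#
      v≢0 = ⁻¹-≢0 y≢0
      l m : Carrier
      l = - (v * D r t)
      m = v * D p t * u
      l≢0 : l ≢ 0#
      l≢0 = neg-≢0 (*-≢0 v≢0 (D-≢0 r≢t))
      m≢0 : m ≢ 0#
      m≢0 = *-≢0 (*-≢0 v≢0 (D-≢0 p≢t)) u≢0
      det : l * X p * (m * Y r) - m * X r * (l * Y p) ≡ 1#
      det = begin
        l * X p * (m * Y r) - m * X r * (l * Y p)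
          ≡⟨ solve 8 (λ v dr dp u x y x′ y′ →
               :- (v :* dr) :* x :* (v :* dp :* u :* y′) :- v :* dp :* u :* x′ :* (:- (v :* dr) :* y)
                 := v :* v :* (:- ((x :* y′ :- x′ :* y) :* dr :* dp :* u))) refl v (D r t) (D p t) u (X p) (Y p) (X r) (Y r) ⟩
        v * v * w            ≡⟨ cong (v * v *_) (sym (proj₂ w-square)) ⟩
        v * v * (y * y)      ≡⟨ solve 2 (λ v y → v :* v :* (y :* y) := y :* v :* (y :* v)) refl v y ⟩
        y * v * (y * v)      ≡⟨ cong₂ _*_ (⁻¹-inverse y y≢0) (⁻¹-inverse y y≢0) ⟩
        1# * 1#              ≡⟨ *-identityˡ 1# ⟩
        1#                   ∎
      g : PSL2 F
      g = mat (l * X p) (m * X r) (l * Y p) (m * Y r) det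
      sends-∞ : Sends g nothing p
      sends-∞ = sends l l≢0
        (solve 2 (λ e f → e :* con (+ 1) :+ f :* con (+ 0) := e) refl (l * X p) (m * X r))
        (solve 2 (λ e f → e :* con (+ 1) :+ f :* con (+ 0) := e) refl (l * Y p) (m * Y r))
      sends-0 : Sends g 0P r
      sends-0 = sends m m≢0
        (solve 2 (λ e f → e :* con (+ 0) :+ f :* con (+ 1) := f) refl (l * X p) (m * X r))
        (solve 2 (λ e f → e :* con (+ 0) :+ f :* con (+ 1) := f) refl (l * Y p) (m * Y r))
      sends-u : Sends g (just u) t
      sends-u = sends (v * u * D p r) (*-≢0 (*-≢0 v≢0 u≢0) (D-≢0 p≢r))
        (solve 8 (λ v u x₁ y₁ x₂ y₂ x₃ y₃ →
            :- (v :* (x₂ :* y₃ :- x₃ :* y₂)) :* x₁ :* u :+ v :* (x₁ :* y₃ :- x₃ :* y₁) :* u :* x₂ :* con (+ 1)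
              := v :* u :* (x₁ :* y₂ :- x₂ :* y₁) :* x₃) refl v u (X p) (Y p) (X r) (Y r) (X t) (Y t))
        (solve 8 (λ v u x₁ y₁ x₂ y₂ x₃ y₃ →
            :- (v :* (x₂ :* y₃ :- x₃ :* y₂)) :* y₁ :* u :+ v :* (x₁ :* y₃ :- x₃ :* y₁) :* u :* y₂ :* con (+ 1)
              := v :* u :* (x₁ :* y₂ :- x₂ :* y₁) :* y₃) refl v u (X p) (Y p) (X r) (Y r) (X t) (Y t))

  transitive : ∀ {T T′} → Distinct T → Distinct T′ → τ T ≡ τ T′ → ∃ λ g → act³ g T ≡ T′
  transitive {T} {T′} dT dT′ τ≡ with from-standard T dT | from-standard T′ dT′
  ... | g , gS≡T | g′ , g′S≡T′ = g′ ∙ inv g , (begin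
    act³ (g′ ∙ inv g) T                              ≡⟨ act³-∙ g′ (inv g) T ⟩
    act³ g′ (act³ (inv g) T)                         ≡⟨ cong (act³ g′ ∘ act³ (inv g)) (sym gS≡T) ⟩
    act³ g′ (act³ (inv g) (act³ g (standard (τ T)))) ≡⟨ cong (act³ g′) (act³-inv-act³ g (standard (τ T))) ⟩
    act³ g′ (standard (τ T))                         ≡⟨ cong (act³ g′ ∘ standard) τ≡ ⟩
    act³ g′ (standard (τ T′))                        ≡⟨ g′S≡T′ ⟩
    T′                                               ∎)
    where open ≡-Reasoning

  -- Conjugation by `h`, which takes the standard triple to `T`, reduces this to a transformation
  -- that fixes the standard triple.
  fixes³⇒identity : ∀ g {T} → Distinct T → act³ g T ≡ T → ∀ p → act F g p ≡ p
  fixes³⇒identity g {T} dT fix p with from-standard T dT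
  ... | h , hS≡T = begin
    act F g p                                    ≡⟨ cong (act F g) (sym (act-act-inv h p)) ⟩
    act F g (act F h p′)                         ≡⟨ sym (act-act-inv h _) ⟩
    act F h (act F (inv h) (act F g (act F h p′))) ≡⟨ cong (act F h) (sym (conj p′)) ⟩
    act F h (act F (inv h ∙ (g ∙ h)) p′)         ≡⟨ cong (act F h) (fixes-standard⇒identity (inv h ∙ (g ∙ h)) u≢0 fixS p′) ⟩
    act F h p′                                   ≡⟨ act-act-inv h p ⟩
    p                                            ∎
    where
    open ≡-Reasoning
    p′ = act F (inv h) p
    u≢0 : representative (τ T) ≢ 0#
    u≢0 = representative-≢0 (τ T)
    conj : ∀ r → act F (inv h ∙ (g ∙ h)) r ≡ act F (inv h) (act F g (act F h r))
    conj r = trans (act-∙ (inv h) (g ∙ h) r) (cong (act F (inv h)) (act-∙ g h r))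
    fixS : act³ (inv h ∙ (g ∙ h)) (standard (τ T)) ≡ standard (τ T)
    fixS = begin
      act³ (inv h ∙ (g ∙ h)) (standard (τ T))            ≡⟨ act³-∙ (inv h) (g ∙ h) (standard (τ T)) ⟩
      act³ (inv h) (act³ (g ∙ h) (standard (τ T)))       ≡⟨ cong (act³ (inv h)) (act³-∙ g h (standard (τ T))) ⟩
      act³ (inv h) (act³ g (act³ h (standard (τ T))))    ≡⟨ cong (act³ (inv h) ∘ act³ g) hS≡T ⟩
      act³ (inv h) (act³ g T)                            ≡⟨ cong (act³ (inv h)) (trans fix (sym hS≡T)) ⟩
      act³ (inv h) (act³ h (standard (τ T)))             ≡⟨ act³-inv-act³ h (standard (τ T)) ⟩
      standard (τ T)                                     ∎

  act³≡⇒Agree : ∀ g h {T} → Distinct T → act³ g T ≡ act³ h T → Agree g h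
  act³≡⇒Agree g h {T} dT eq p = trans (sym (act-act-inv h _)) (cong (act F h)
    (trans (sym (act-∙ (inv h) g p)) (fixes³⇒identity (inv h ∙ g) dT
      (trans (act³-∙ (inv h) g T) (trans (cong (act³ (inv h)) eq) (act³-inv-act³ h T))) p)))

-- Counting blocks

module Blocks {q : ℕ} (F : FiniteField q) (k : ℕ) (q≡1+52k : q ≡ suc (k ℕ.* 52))
  (α : FiniteField.Carrier F) (generates : IsPrimitiveRoot F α) where
  open FiniteField F
  open Enumeration F
  open ProjectiveLine F
  open TripleType F k q≡1+52k α generates

  points : List (Point F)
  points = nothing ∷ map just elements

  ∈-points : ∀ p → p ∈ points
  ∈-points nothing  = here refl
  ∈-points (just x) = there (∈-map⁺ just (∈-elements x))

  allPoints? : {P : Pred (Point F) ℓ} → Decidable P → Dec (∀ p → P p)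
  allPoints? P? = map′ (λ all p → All.lookup all (∈-points p)) (λ ∀P → All.tabulate λ {p} _ → ∀P p) (All.all? P? points)

  private
    fromEntries : Carrier × Carrier × Carrier × Carrier → List (PSL2 F)
    fromEntries (a , b , c , d) with (a * d - b * c) ≟ 1#
    ... | yes det = mat a b c d det ∷ []
    ... | no  _   = []

    ∈-fromEntries : ∀ a b c d det → mat a b c d det ∈ fromEntries (a , b , c , d)
    ∈-fromEntries a b c d det with (a * d - b * c) ≟ 1#
    ... | yes det′ = here (cong (mat a b c d) (≡-irrelevant det det′))
    ... | no  ¬det = contradiction det ¬det

  abstract
    transformations : List (PSL2 F)
    transformations = concatMap fromEntries
      (cartesianProduct elements (cartesianProduct elements (cartesianProduct elements elements)))

    ∈-transformations : ∀ g → g ∈ transformations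
    ∈-transformations (mat a b c d det) = ∈-concat⁺′ (∈-fromEntries a b c d det) (∈-map⁺ fromEntries
      (∈-cartesianProduct⁺ (∈-elements a) (∈-cartesianProduct⁺ (∈-elements b)
        (∈-cartesianProduct⁺ (∈-elements c) (∈-elements d)))))

  _≟ᴾ_ : (p r : Point F) → Dec (p ≡ r)
  _≟ᴾ_ = ≡-dec _≟_

  Agree? : ∀ g h → Dec (Agree g h)
  Agree? g h = allPoints? λ p → act F g p ≟ᴾ act F h p

  -- The orbit of a block and its stabilizer

  module Orbit {B : Subset F} (B? : Decidable B) where

    InB : Point F → Set
    InB p = ∃ λ x → B x × just x ≡ p

    InB³ : Triple → Set
    InB³ (p , r , t) = InB p × InB r × InB t

    InB? : Decidable InB
    InB? nothing = no λ ()
    InB? (just x) = map′ (λ Bx → x , Bx , refl) (λ { (_ , Bx , refl) → Bx }) (B? x)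

    -- Moving `g` to the other side replaces the search for a preimage in B by a decidable
    -- membership test.
    image⇔InB : ∀ g {p} → image F g B p ⇔ InB (act F (inv g) p)
    image⇔InB g {p} = mk⇔ (λ { (x , Bx , gx≡p) → x , Bx , sym (act-inv g gx≡p) })
      (λ { (x , Bx , x≡g⁻¹p) → x , Bx , trans (cong (act F g) x≡g⁻¹p) (act-act-inv g p) })

    contains⇔InB³ : ∀ g {p r t} → Contains3 F g B p r t ⇔ InB³ (act³ (inv g) (p , r , t))
    contains⇔InB³ g = mk⇔
      (λ { (a , b , c) → Equivalence.to (image⇔InB g) a , Equivalence.to (image⇔InB g) b
                         , Equivalence.to (image⇔InB g) c })
      (λ { (a , b , c) → Equivalence.from (image⇔InB g) a , Equivalence.from (image⇔InB g) b
                         , Equivalence.from (image⇔InB g) c })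

    Stabilizes : PSL2 F → Set
    Stabilizes σ = ∀ p → InB (act F σ p) ⇔ InB p

    Stabilizes? : Decidable Stabilizes
    Stabilizes? σ = allPoints? λ p → map′ (λ (f , g) → mk⇔ f g) (λ e → Equivalence.to e , Equivalence.from e)
      ((InB? (act F σ p) →-dec InB? p) ×-dec (InB? p →-dec InB? (act F σ p)))

    stabilizes-ι : Stabilizes ι
    stabilizes-ι p = subst (λ r → InB r ⇔ InB p) (sym (act-ι p)) ⇔-refl

    -- g B = h B means that h⁻¹ g fixes B setwise. With the converse, this makes equality of blocks
    -- decidable by testing finitely many points.
    sameBlock⇒stabilizes : ∀ {g h} → SameBlock F g h B → Stabilizes (inv h ∙ g)
    sameBlock⇒stabilizes {g} {h} same p = subst₂ (λ r t → InB r ⇔ InB t)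
      (sym (act-∙ (inv h) g p)) (act-inv-act g p)
      (⇔-trans (⇔-sym (image⇔InB h)) (⇔-trans (⇔-sym (same (act F g p))) (image⇔InB g)))

    stabilizes⇒sameBlock : ∀ {g h} → Stabilizes (inv h ∙ g) → SameBlock F g h B
    stabilizes⇒sameBlock {g} {h} stab p = ⇔-trans (image⇔InB g) (⇔-trans (⇔-sym (stab (act F (inv g) p)))
      (subst (λ r → InB r ⇔ image F h B p)
        (sym (trans (act-∙ (inv h) g (act F (inv g) p)) (cong (act F (inv h)) (act-act-inv g p)))) (⇔-sym (image⇔InB h))))

    SameBlock? : ∀ g h → Dec (SameBlock F g h B)
    SameBlock? g h = map′ (stabilizes⇒sameBlock {g} {h}) (sameBlock⇒stabilizes {g} {h}) (Stabilizes? (inv h ∙ g))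

    agree⇒sameBlock : ∀ {g h} → Agree g h → SameBlock F g h B
    agree⇒sameBlock agree p = mk⇔ (λ { (x , Bx , eq) → x , Bx , trans (sym (agree (just x))) eq })
                                  (λ { (x , Bx , eq) → x , Bx , trans (agree (just x)) eq })

    sameBlock-∙ : ∀ g {σ} → Stabilizes σ → SameBlock F g (g ∙ σ) B
    sameBlock-∙ g {σ} stab p = ⇔-trans (image⇔InB g) (⇔-trans
      (subst (λ r → InB r ⇔ InB σ⁻¹g⁻¹p) (act-act-inv σ (act F (inv g) p)) (stab σ⁻¹g⁻¹p))
      (subst (λ r → InB r ⇔ image F (g ∙ σ) B p) [gσ]⁻¹p≡ (⇔-sym (image⇔InB (g ∙ σ)))))
      where
      σ⁻¹g⁻¹p = act F (inv σ) (act F (inv g) p)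
      [gσ]⁻¹p≡ : act F (inv (g ∙ σ)) p ≡ σ⁻¹g⁻¹p
      [gσ]⁻¹p≡ = act-inv (g ∙ σ) (trans (act-∙ g σ σ⁻¹g⁻¹p)
        (trans (cong (act F g) (act-act-inv σ (act F (inv g) p))) (act-act-inv g p)))

    abstract
      stabilizer-spec : Σ (List (PSL2 F)) λ S → All Stabilizes S × AllPairs (λ σ ρ → ¬ Agree σ ρ) S
        × (∀ {σ} → σ ∈ transformations → Stabilizes σ → ∃ λ ρ → ρ ∈ S × Agree σ ρ)
      stabilizer-spec = transversal Stabilizes? Agree? (λ {g} p → refl) transformations

    -- Its entries are pairwise distinct as transformations, so its length is the order of the
    -- setwise stabilizer of B in PSL(2,q).
    stabilizer : List (PSL2 F)
    stabilizer = proj₁ stabilizer-spec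

    private
      stabilizer-sound : ∀ {σ} → σ ∈ stabilizer → Stabilizes σ
      stabilizer-sound = All.lookup (proj₁ (proj₂ stabilizer-spec))

      stabilizer-distinct : AllPairs (λ σ ρ → ¬ Agree σ ρ) stabilizer
      stabilizer-distinct = proj₁ (proj₂ (proj₂ stabilizer-spec))

      stabilizer-complete : ∀ σ → Stabilizes σ → ∃ λ ρ → ρ ∈ stabilizer × Agree σ ρ
      stabilizer-complete σ = proj₂ (proj₂ (proj₂ stabilizer-spec)) (∈-transformations σ)

      instance
        length-stabilizer≢0 : NonZero (length stabilizer)
        length-stabilizer≢0 = ℕ.>-nonZero (∈-length (proj₁ (proj₂ (stabilizer-complete ι stabilizes-ι))))

    contains? : ∀ p r t g → Dec (Contains3 F g B p r t)
    contains? p r t g = map′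
      (Equivalence.from (contains⇔InB³ g {p} {r} {t})) (Equivalence.to (contains⇔InB³ g {p} {r} {t}))
      (InB? (act F (inv g) p) ×-dec (InB? (act F (inv g) r) ×-dec InB? (act F (inv g) t)))

    abstract
      blocks-transversal : ∀ p r t → Σ (List (PSL2 F)) λ gs → All (λ g → Contains3 F g B p r t) gs
        × AllPairs (λ g h → ¬ SameBlock F g h B) gs
        × (∀ {g} → g ∈ transformations → Contains3 F g B p r t → ∃ λ h → h ∈ gs × SameBlock F g h B)
      blocks-transversal p r t = transversal (contains? p r t) SameBlock? (λ {g} p → ⇔-refl) transformations

    -- Some number of blocks exists for every triple; the design property adds that this number is
    -- positive and constant on distinct triples.
    blocksContaining : ∀ p r t → ∃ λ lam → ExactlyBlocksContaining F B lam p r t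
    blocksContaining p r t =
      let gs , contain , distinct , complete = blocks-transversal p r t
      in length gs , gs , refl , contain , distinct , λ g → complete (∈-transformations g)

    module _ (L : Sign → List Triple) (L-unique : ∀ s → Unique (L s))
      (∈L : ∀ {s T} → T ∈ L s ⇔ (InB³ T × Distinct T × τ T ≡ s)) where

      -- (g, σ) ↦ (g σ)⁻¹ T is a bijection from the blocks g B through T, times the stabilizer of B,
      -- onto the triples of B of the same type as T.
      blocks*stabilizer : ∀ {lam p r t} → Distinct (p , r , t) → ExactlyBlocksContaining F B lam p r t →
        lam ℕ.* length stabilizer ≡ length (L (τ (p , r , t)))
      blocks*stabilizer {p = p} {r} {t} dT (gs , refl , contain , distinct , complete) =
        trans (sym (length-cartesianProductWith f gs stabilizer))
          (unique∧set⇒length≡ (cartesianProductWith-unique g≢ σ≢ distinct stabilizer-distinct) (L-unique (τ T)) (mk⇔ to from))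
        where
        T : Triple
        T = p , r , t
        f : PSL2 F → PSL2 F → Triple
        f g σ = act³ (inv (g ∙ σ)) T
        -- Injectivity: both products send the common triple to `T`, and a transformation is
        -- determined by its action on one triple of distinct points.
        f≡⇒agree : ∀ {g g′ σ σ′} → f g σ ≡ f g′ σ′ → Agree (g ∙ σ) (g′ ∙ σ′)
        f≡⇒agree {g} {g′} {σ} {σ′} eq = act³≡⇒Agree (g ∙ σ) (g′ ∙ σ′) (act³-distinct (inv (g ∙ σ)) dT)
          (trans (act³-act³-inv (g ∙ σ) T) (sym (trans (cong (act³ (g′ ∙ σ′)) eq) (act³-act³-inv (g′ ∙ σ′) T))))
        g≢ : ∀ {g g′ σ σ′} → ¬ SameBlock F g g′ B → σ ∈ stabilizer → σ′ ∈ stabilizer → f g σ ≢ f g′ σ′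
        g≢ {g} {g′} {σ} {σ′} ¬same σ∈ σ′∈ eq = ¬same λ x → ⇔-trans (sameBlock-∙ g (stabilizer-sound σ∈) x)
          (⇔-trans (agree⇒sameBlock {g ∙ σ} {g′ ∙ σ′} (f≡⇒agree {g} {g′} {σ} {σ′} eq) x)
            (⇔-sym (sameBlock-∙ g′ (stabilizer-sound σ′∈) x)))
        σ≢ : ∀ g {σ σ′} → ¬ Agree σ σ′ → f g σ ≢ f g σ′
        σ≢ g {σ} {σ′} ¬agree eq = ¬agree λ x → act-injective g
          (trans (sym (act-∙ g σ x)) (trans (f≡⇒agree {g} {g} {σ} {σ′} eq x) (act-∙ g σ′ x)))
        f∈L : ∀ {g σ} → g ∈ gs → σ ∈ stabilizer → f g σ ∈ L (τ T)
        f∈L {g} {σ} g∈ σ∈ = Equivalence.from ∈L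
          ( Equivalence.to (contains⇔InB³ (g ∙ σ) {p} {r} {t})
              ( Equivalence.to (same p) (proj₁ Tg) , Equivalence.to (same r) (proj₁ (proj₂ Tg))
              , Equivalence.to (same t) (proj₂ (proj₂ Tg)))
          , act³-distinct (inv (g ∙ σ)) dT , τ-act³ (inv (g ∙ σ)) T dT)
          where
          same : SameBlock F g (g ∙ σ) B
          same = sameBlock-∙ g (stabilizer-sound σ∈)
          Tg : Contains3 F g B p r t
          Tg = All.lookup contain g∈
        hσu≡T : ∀ {g h σ u} → Agree (inv h ∙ g) σ → act³ g u ≡ T → act³ (h ∙ σ) u ≡ T
        hσu≡T {g} {h} {σ} {u} agree gu≡T = trans
          (triple≡ (hσ≡g (proj₁ u)) (hσ≡g (proj₁ (proj₂ u))) (hσ≡g (proj₂ (proj₂ u)))) gu≡T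
          where
          open ≡-Reasoning
          hσ≡g : ∀ x → act F (h ∙ σ) x ≡ act F g x
          hσ≡g x = begin
            act F (h ∙ σ) x                        ≡⟨ act-∙ h σ x ⟩
            act F h (act F σ x)                    ≡⟨ cong (act F h) (sym (agree x)) ⟩
            act F h (act F (inv h ∙ g) x)          ≡⟨ cong (act F h) (act-∙ (inv h) g x) ⟩
            act F h (act F (inv h) (act F g x))    ≡⟨ act-act-inv h (act F g x) ⟩
            act F g x                              ∎
        to : ∀ {u} → u ∈ cartesianProductWith f gs stabilizer → u ∈ L (τ T)
        to u∈ = let g , σ , g∈ , σ∈ , u≡ = ∈-cartesianProductWith⁻ f gs stabilizer u∈ in
          subst (_∈ L (τ T)) (sym u≡) (f∈L {g} {σ} g∈ σ∈)
        contains-image : ∀ g u → InB³ u → act³ g u ≡ T → Contains3 F g B p r t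
        contains-image g u u∈B gu≡T = Equivalence.from (contains⇔InB³ g {p} {r} {t})
          (subst InB³ (trans (sym (act³-inv-act³ g u)) (cong (act³ (inv g)) gu≡T)) u∈B)
        -- Surjectivity: equal types give `g` with g u = T, so g B contains T; if `h` represents
        -- this block, then σ = h⁻¹ g stabilizes B and (h σ)⁻¹ T = u.
        from : ∀ {u} → u ∈ L (τ T) → u ∈ cartesianProductWith f gs stabilizer
        from {u} u∈ =
          let u∈B , du , τu = Equivalence.to ∈L u∈
              g , gu≡T = transitive du dT τu
              h , h∈ , same = complete g (contains-image g u u∈B gu≡T)
              σ , σ∈ , agree = stabilizer-complete (inv h ∙ g) (sameBlock⇒stabilizes {g} {h} same)
              fhσ≡u : f h σ ≡ u
              fhσ≡u = trans (cong (act³ (inv (h ∙ σ))) (sym (hσu≡T {g} {h} {σ} {u} agree gu≡T))) (act³-inv-act³ (h ∙ σ) u)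
          in subst (_∈ cartesianProductWith f gs stabilizer) fhσ≡u (∈-cartesianProductWith⁺ f h∈ σ∈)

      -- The number of blocks through a triple, times the order `n` of the stabilizer, depends on
      -- the type alone, and both types occur on the projective line, namely at the standard
      -- triples. Cancelling `n` leaves equality of the two counts; the given triple of B makes λ
      -- positive.
      orbitIs3Design⇔ : ∀ {s T} → T ∈ L s → OrbitIs3Design F B ⇔ (length (L Sign.+) ≡ length (L Sign.-))
      orbitIs3Design⇔ {s₀} T₀∈ = mk⇔ to from
        where
        n : ℕ
        n = length stabilizer
        Exactly³ : ℕ → Triple → Set
        Exactly³ lam T = ExactlyBlocksContaining F B lam (proj₁ T) (proj₁ (proj₂ T)) (proj₂ (proj₂ T))
        count : ∀ lam T s → τ T ≡ s → Distinct T → Exactly³ lam T → lam ℕ.* n ≡ length (L s)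
        count lam T s τT≡s dT exactly = trans (blocks*stabilizer dT exactly) (cong (λ s → length (L s)) τT≡s)
        exactly-blocksContaining : ∀ T → ∃ λ lam → Exactly³ lam T
        exactly-blocksContaining T = blocksContaining (proj₁ T) (proj₁ (proj₂ T)) (proj₂ (proj₂ T))
        to : OrbitIs3Design F B → length (L Sign.+) ≡ length (L Sign.-)
        to (lam , _ , exactly) = trans (sym (count-standard Sign.+)) (count-standard Sign.-)
          where
          exactly³ : ∀ T → Distinct T → Exactly³ lam T
          exactly³ (p , r , t) (p≢r , p≢t , r≢t) = exactly p r t p≢r p≢t r≢t
          count-standard : ∀ s → lam ℕ.* n ≡ length (L s)
          count-standard s = count lam (standard s) s (τ-standard s) (standard-distinct s)
            (exactly³ (standard s) (standard-distinct s))
        from : length (L Sign.+) ≡ length (L Sign.-) → OrbitIs3Design F B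
        from balanced = lam , ℕₚ.n≢0⇒n>0 lam≢0 , λ p r t p≢r p≢t r≢t → exactly³ (p , r , t) (p≢r , p≢t , r≢t)
          where
          lam : ℕ
          lam = proj₁ (exactly-blocksContaining (standard Sign.+))
          count-any : ∀ s → lam ℕ.* n ≡ length (L s)
          count-any Sign.+ = count lam (standard Sign.+) Sign.+ (τ-standard Sign.+) (standard-distinct Sign.+)
            (proj₂ (exactly-blocksContaining (standard Sign.+)))
          count-any Sign.- = trans (count-any Sign.+) balanced
          exactly³ : ∀ T → Distinct T → Exactly³ lam T
          exactly³ T dT = let lam′ , exactly′ = exactly-blocksContaining T in
            subst (λ m → Exactly³ m T)
              (ℕₚ.*-cancelʳ-≡ lam′ lam n (trans (count lam′ T (τ T) refl dT exactly′) (sym (count-any (τ T))))) exactly′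
          lam≢0 : lam ≢ 0
          lam≢0 lam≡0 = ℕₚ.<⇒≢ (∈-length T₀∈) (trans (cong (ℕ._* n) (sym lam≡0)) (count-any s₀))

-- Sign patterns

positives : ℕ → List ℕ
positives K = map suc (upTo (K ∸ 1))

pairs : ℕ → List (ℕ × ℕ)
pairs K = filter (λ (a , b) → ¬? (a ℕ.≟ b)) (cartesianProduct (positives K) (positives K))

sign : (ℕ → Sign) → ℕ × ℕ → Sign
sign f (a , b) = f a Sign.* f ∣ a - b ∣ Sign.* f b

pairsOfSign : (ℕ → Sign) → ℕ → Sign → List (ℕ × ℕ)
pairsOfSign f K s = filter (λ ab → sign f ab Signₚ.≟ s) (pairs K)

Balanced : (ℕ → Sign) → ℕ → Set
Balanced f K = length (pairsOfSign f K Sign.+) ≡ length (pairsOfSign f K Sign.-)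

nth : List Sign → ℕ → Sign
nth []       _       = Sign.+
nth (s ∷ ss) zero    = s
nth (s ∷ ss) (suc n) = nth ss n

-- The entries after position 0 form a palindrome because f(13 - j) = f(j). Position 0 only shifts
-- the indices.
table₁₃ : Vec Sign 6 → ℕ → Sign
table₁₃ (a ∷ b ∷ c ∷ d ∷ e ∷ f ∷ []) = nth (Sign.+ ∷ a ∷ b ∷ c ∷ d ∷ e ∷ f ∷ f ∷ e ∷ d ∷ c ∷ b ∷ a ∷ [])

-- Position 2i holds the order-13 value at i, because γ² = β. For odd j ≠ 13, f(j) = f(2j) f(j + 13)
-- is the product of the order-13 values at j and (j + 13)/2, reflected into 1, ..., 6; position 13
-- holds `u`.
table₂₆ : Sign → Vec Sign 6 → ℕ → Sign
table₂₆ u (a ∷ b ∷ c ∷ d ∷ e ∷ f ∷ []) = nth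
  (Sign.+ ∷ a · f ∷ a ∷ c · e ∷ b ∷ e · d ∷ c ∷ f · c ∷ d ∷ d · b ∷ e ∷ b · a ∷ f ∷ u
          ∷ f ∷ b · a ∷ e ∷ d · b ∷ d ∷ f · c ∷ c ∷ e · d ∷ b ∷ c · e ∷ a ∷ a · f ∷ [])
  where
  infixl 7 _·_
  _·_ = Sign._*_

∀Sign? : {P : Pred Sign ℓ} → Decidable P → Dec (∀ s → P s)
∀Sign? P? = map′ (λ { (p , m) Sign.+ → p ; (p , m) Sign.- → m }) (λ ∀P → ∀P Sign.+ , ∀P Sign.-)
  (P? Sign.+ ×-dec P? Sign.-)

∀Vec? : ∀ n {P : Pred (Vec Sign n) ℓ} → Decidable P → Dec (∀ v → P v)
∀Vec? zero    P? = map′ (λ { p [] → p }) (λ ∀P → ∀P []) (P? [])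
∀Vec? (suc n) P? = map′ (λ { ∀P (s ∷ v) → ∀P s v }) (λ ∀P s v → ∀P (s ∷ v)) (∀Sign? λ s → ∀Vec? n λ v → P? (s ∷ v))

open Data.List.Membership.DecPropositional (Vecₚ.≡-dec {n = 6} Signₚ._≟_) using (_∈?_)

characterizes? : ∀ K (table : Vec Sign 6 → ℕ → Sign) v → Dec (Balanced (table v) K ⇔ v ∈ admissible)
characterizes? K table v = map′ (λ (f , g) → mk⇔ f g) (λ e → Equivalence.to e , Equivalence.from e)
  ((balanced? →-dec v ∈? admissible) ×-dec (v ∈? admissible →-dec balanced?))
  where
  balanced? : Dec (Balanced (table v) K)
  balanced? = length (pairsOfSign (table v) K Sign.+) ℕ.≟ length (pairsOfSign (table v) K Sign.-)

-- Evaluation of 64 patterns, each on 12 · 11 ordered pairs.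
balanced₁₃⇔admissible : ∀ v → Balanced (table₁₃ v) 13 ⇔ v ∈ admissible
balanced₁₃⇔admissible = from-yes (∀Vec? 6 (characterizes? 13 table₁₃))

-- A pair in which a, b or |a - b| is 13 contributes u f(j) f(j + 13) = u f(2j), and these terms add
-- up to a multiple of u times the sum of the six signs. That sum is 0 for each admissible pattern,
-- which is why `u` cancels there; the equivalence itself rests on evaluating all 128 cases.
balanced₂₆⇔admissible : ∀ u v → Balanced (table₂₆ u v) 26 ⇔ v ∈ admissible
balanced₂₆⇔admissible = from-yes (∀Sign? λ u → ∀Vec? 6 (characterizes? 26 (table₂₆ u)))

-- Cyclic subgroups

∈-positives⁺ : ∀ {K a} → 0 < a → a < K → a ∈ positives K
∈-positives⁺ {suc K} {suc a} _ (s≤s a<K) = ∈-map⁺ suc (∈-upTo⁺ a<K)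

∈-positives⁻ : ∀ {K a} → a ∈ positives K → 0 < a × a < K
∈-positives⁻ {zero} ()
∈-positives⁻ {suc K} a∈ with ∈-map⁻ suc a∈
... | b , b∈ , refl = s≤s z≤n , s≤s (∈-upTo⁻ b∈)

∈-pairs⁺ : ∀ {K a b} → 0 < a → a < K → 0 < b → b < K → a ≢ b → (a , b) ∈ pairs K
∈-pairs⁺ 0<a a<K 0<b b<K a≢b = ∈-filter⁺ _
  (∈-cartesianProduct⁺ (∈-positives⁺ 0<a a<K) (∈-positives⁺ 0<b b<K)) a≢b

∈-pairs⁻ : ∀ {K a b} → (a , b) ∈ pairs K → (0 < a × a < K) × (0 < b × b < K) × a ≢ b
∈-pairs⁻ {K} ab∈ with ∈-filter⁻ (λ (a , b) → ¬? (a ℕ.≟ b)) {xs = cartesianProduct (positives K) (positives K)} ab∈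
... | ab∈′ , a≢b with ∈-cartesianProduct⁻ (positives K) (positives K) ab∈′
...   | a∈ , b∈ = ∈-positives⁻ a∈ , ∈-positives⁻ b∈ , a≢b

positives-unique : ∀ K → Unique (positives K)
positives-unique K = Uniqueₚ.map⁺ ℕₚ.suc-injective (Uniqueₚ.upTo⁺ (K ∸ 1))

pairs-unique : ∀ K → Unique (pairs K)
pairs-unique K = Uniqueₚ.filter⁺ _ (Uniqueₚ.cartesianProduct⁺ (positives-unique K) (positives-unique K))

∣a-b∣>0 : ∀ {a b} → a ≢ b → 0 < ∣ a - b ∣
∣a-b∣>0 a≢b = ℕₚ.n≢0⇒n>0 (a≢b ∘ ℕₚ.∣m-n∣≡0⇒m≡n)

∣a-b∣<K : ∀ {a b K} → a < K → b < K → ∣ a - b ∣ < K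
∣a-b∣<K {a} {b} a<K b<K = ℕₚ.≤-<-trans (ℕₚ.∣m-n∣≤m⊔n a b) (ℕₚ.⊔-lub a<K b<K)

-- The indices a, b and |a - b| all lie strictly between 0 and K, so agreement in that range is
-- enough to replace the character by a finite table.
balanced-cong : ∀ {f g K} → (∀ {j} → 0 < j → j < K → f j ≡ g j) → Balanced f K ⇔ Balanced g K
balanced-cong {f} {g} {K} f≗g = mk⇔ (λ eq → trans (sym (count Sign.+)) (trans eq (count Sign.-)))
                                    (λ eq → trans (count Sign.+) (trans eq (sym (count Sign.-))))
  where
  sign-cong : ∀ {ab} → ab ∈ pairs K → sign f ab ≡ sign g ab
  sign-cong ab∈ with ∈-pairs⁻ {K} ab∈
  ... | (0<a , a<K) , (0<b , b<K) , a≢b =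
    cong₂ Sign._*_ (cong₂ Sign._*_ (f≗g 0<a a<K) (f≗g (∣a-b∣>0 a≢b) (∣a-b∣<K a<K b<K))) (f≗g 0<b b<K)
  count : ∀ s → length (pairsOfSign f K s) ≡ length (pairsOfSign g K s)
  count s = length-filter-cong _ _ λ ab∈ → mk⇔ (trans (sym (sign-cong ab∈))) (trans (sign-cong ab∈))

module CyclicTriples {q : ℕ} (F : FiniteField q) (k : ℕ) (q≡1+52k : q ≡ suc (k ℕ.* 52))
  (α : FiniteField.Carrier F) (generates : IsPrimitiveRoot F α)
  (h K : ℕ) .{{_ : NonZero K}} (h*K≡N : h ℕ.* K ≡ k ℕ.* 52) (h-even : parity h ≡ Sign.+) (3≤K : 3 ≤ K) where
  open FiniteField F
  open FieldProperties F
  open PrimitiveRoot F k q≡1+52k α generates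
  open CyclicSubgroup h K h*K≡N
  open ProjectiveLine F
  open TripleType F k q≡1+52k α generates
  open Blocks F k q≡1+52k α generates

  f : ℕ → Sign
  f j = χ (1# - γ ^ j)

  χγ≡+ : χ γ ≡ Sign.+
  χγ≡+ = trans (χ-α^ h) h-even

  χ[γ^n]≡+ : ∀ n → χ (γ ^ n) ≡ Sign.+
  χ[γ^n]≡+ zero    = χ-α^ 0
  χ[γ^n]≡+ (suc n) = trans (χ-* γ≢0 (γ^-≢0 n)) (cong₂ Sign._*_ χγ≡+ (χ[γ^n]≡+ n))

  -- γ is a square because `h` is even. This is what makes types invariant under rotation of the
  -- exponents.
  χ-γ^* : ∀ n {x} → x ≢ 0# → χ (γ ^ n * x) ≡ χ x
  χ-γ^* n {x} x≢0 = trans (χ-* (γ^-≢0 n) x≢0) (cong (Sign._* χ x) (χ[γ^n]≡+ n))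

  1-γ^-≢0 : ∀ {j} → 0 < j → j < K → 1# - γ ^ j ≢ 0#
  1-γ^-≢0 0<j j<K eq = γ^n≢1 0<j j<K (sym (x-y≡0⇒x≡y eq))

  γ^a-γ^b≢0 : ∀ {a b} → a < K → b < K → a ≢ b → γ ^ a - γ ^ b ≢ 0#
  γ^a-γ^b≢0 a<K b<K a≢b eq = a≢b (γ^-injective a<K b<K (x-y≡0⇒x≡y eq))

  χ[γ^a-γ^b]-≤ : ∀ {a b} → a ≤ b → b < K → a ≢ b → χ (γ ^ a - γ ^ b) ≡ f (b ∸ a)
  χ[γ^a-γ^b]-≤ {a} {b} a≤b b<K a≢b = trans (cong χ γ^a-γ^b≡)
    (χ-γ^* a (1-γ^-≢0 (ℕₚ.m<n⇒0<n∸m (ℕₚ.≤∧≢⇒< a≤b a≢b)) (ℕₚ.≤-<-trans (ℕₚ.m∸n≤m b a) b<K)))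
    where
    γ^a-γ^b≡ : γ ^ a - γ ^ b ≡ γ ^ a * (1# - γ ^ (b ∸ a))
    γ^a-γ^b≡ = trans (cong (λ z → γ ^ a - z) (trans (cong (γ ^_) (sym (ℕₚ.m+[n∸m]≡n a≤b))) (^-+ γ a (b ∸ a))))
      (solve 2 (λ x y → x :- x :* y := x :* (con (+ 1) :- y)) refl (γ ^ a) (γ ^ (b ∸ a)))

  χ[γ^a-γ^b] : ∀ {a b} → a < K → b < K → a ≢ b → χ (γ ^ a - γ ^ b) ≡ f ∣ a - b ∣
  χ[γ^a-γ^b] {a} {b} a<K b<K a≢b with ℕₚ.≤-total a b
  ... | inj₁ a≤b = trans (χ[γ^a-γ^b]-≤ a≤b b<K a≢b) (cong f (sym (ℕₚ.m≤n⇒∣m-n∣≡n∸m a≤b)))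
  ... | inj₂ b≤a = begin
    χ (γ ^ a - γ ^ b)       ≡⟨ cong χ (solve 2 (λ x y → x :- y := :- (y :- x)) refl (γ ^ a) (γ ^ b)) ⟩
    χ (- (γ ^ b - γ ^ a))   ≡⟨ χ-neg (γ^a-γ^b≢0 b<K a<K (a≢b ∘ sym)) ⟩
    χ (γ ^ b - γ ^ a)       ≡⟨ χ[γ^a-γ^b]-≤ b≤a a<K (a≢b ∘ sym) ⟩
    f (a ∸ b)               ≡⟨ cong f (sym (ℕₚ.m≤n⇒∣n-m∣≡n∸m b≤a)) ⟩
    f ∣ a - b ∣             ∎
    where open ≡-Reasoning

  -- γʲ (1 - γ^(K-j)) = -(1 - γʲ), where γʲ and -1 are squares.
  f-reflect : ∀ {j} → 0 < j → j < K → f (K ∸ j) ≡ f j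
  f-reflect {j} 0<j j<K = begin
    χ (1# - γ ^ (K ∸ j))              ≡⟨ sym (χ-γ^* j (1-γ^-≢0 (ℕₚ.m<n⇒0<n∸m j<K) (ℕₚ.∸-monoʳ-< 0<j (ℕₚ.<⇒≤ j<K)))) ⟩
    χ (γ ^ j * (1# - γ ^ (K ∸ j)))    ≡⟨ cong χ (solve 2 (λ x y → x :* (con (+ 1) :- y) := :- (x :* y :- x)) refl
                                                   (γ ^ j) (γ ^ (K ∸ j))) ⟩
    χ (- (γ ^ j * γ ^ (K ∸ j) - γ ^ j)) ≡⟨ cong (λ z → χ (- (z - γ ^ j))) γ^j*γ^[K∸j]≡1 ⟩
    χ (- (1# - γ ^ j))                ≡⟨ χ-neg (1-γ^-≢0 0<j j<K) ⟩
    χ (1# - γ ^ j)                    ∎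
    where
    open ≡-Reasoning
    γ^j*γ^[K∸j]≡1 : γ ^ j * γ ^ (K ∸ j) ≡ 1#
    γ^j*γ^[K∸j]≡1 = trans (sym (^-+ γ j (K ∸ j))) (trans (cong (γ ^_) (ℕₚ.m+[n∸m]≡n (ℕₚ.<⇒≤ j<K))) γ^K≡1)

  tripleAt : ℕ → ℕ × ℕ → Triple
  tripleAt c (a , b) = just (γ ^ c) , just (γ ^ (c ℕ.+ a)) , just (γ ^ (c ℕ.+ b))

  -- The first exponent `c` does not enter the type, so each pair of differences counts K times and
  -- K cancels from the balance.
  triples : Sign → List Triple
  triples s = cartesianProductWith tripleAt (upTo K) (pairsOfSign f K s)

  length-triples : ∀ s → length (triples s) ≡ K ℕ.* length (pairsOfSign f K s)
  length-triples s = trans (length-cartesianProductWith tripleAt (upTo K) (pairsOfSign f K s))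
    (cong (ℕ._* length (pairsOfSign f K s)) (length-upTo K))

  γ^[c+a]-injective : ∀ c {a b} → γ ^ (c ℕ.+ a) ≡ γ ^ (c ℕ.+ b) → γ ^ a ≡ γ ^ b
  γ^[c+a]-injective c {a} {b} eq = *-cancelˡ (γ^-≢0 c) (trans (sym (^-+ γ c a)) (trans eq (^-+ γ c b)))

  ∈-pairsOfSign⁻ : ∀ {s ab} → ab ∈ pairsOfSign f K s → ab ∈ pairs K × sign f ab ≡ s
  ∈-pairsOfSign⁻ {s} = ∈-filter⁻ (λ ab → sign f ab Signₚ.≟ s)

  triples-unique : ∀ s → Unique (triples s)
  triples-unique s = cartesianProductWith-unique
    -- Powers are compared instead of exponents because c + a is not reduced modulo K; γᶜ cancels,
    -- and injectivity below K then recovers the pair.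
    {R = λ c d → γ ^ c ≢ γ ^ d} {S = λ (a , b) (a′ , b′) → ¬ (γ ^ a ≡ γ ^ a′ × γ ^ b ≡ γ ^ b′)} {f = tripleAt}
    (λ γᶜ≢γᵈ _ _ eq → γᶜ≢γᵈ (just-injective (cong proj₁ eq)))
    (λ c ab≢ eq → ab≢ ( γ^[c+a]-injective c (just-injective (cong (proj₁ ∘ proj₂) eq))
                      , γ^[c+a]-injective c (just-injective (cong (proj₂ ∘ proj₂) eq))))
    (AllPairsₚ.map⁻ powers-unique)
    (AllPairs-map-∈ distinct (Uniqueₚ.filter⁺ (λ ab → sign f ab Signₚ.≟ s) (pairs-unique K)))
    where
    distinct : ∀ {ab ab′} → ab ∈ pairsOfSign f K s → ab′ ∈ pairsOfSign f K s → ab ≢ ab′ →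
      ¬ (γ ^ proj₁ ab ≡ γ ^ proj₁ ab′ × γ ^ proj₂ ab ≡ γ ^ proj₂ ab′)
    distinct ab∈ ab′∈ ab≢ab′ (eq , eq′)
      with ∈-pairs⁻ {K} (proj₁ (∈-pairsOfSign⁻ ab∈)) | ∈-pairs⁻ {K} (proj₁ (∈-pairsOfSign⁻ ab′∈))
    ... | (_ , a<K) , (_ , b<K) , _ | (_ , a′<K) , (_ , b′<K) , _ =
      ab≢ab′ (cong₂ _,_ (γ^-injective a<K a′<K eq) (γ^-injective b<K b′<K eq′))

  tripleAt-distinct : ∀ c {a b} → (a , b) ∈ pairs K → Distinct (tripleAt c (a , b))
  tripleAt-distinct c {a} {b} ab∈ with ∈-pairs⁻ {K} ab∈
  ... | (0<a , a<K) , (0<b , b<K) , a≢b = γᶜ≢ 0<a a<K , γᶜ≢ 0<b b<K ,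
      λ eq → a≢b (γ^-injective a<K b<K (γ^[c+a]-injective c (just-injective eq)))
    where
    γᶜ≢ : ∀ {a} → 0 < a → a < K → just (γ ^ c) ≢ just (γ ^ (c ℕ.+ a))
    γᶜ≢ {a} 0<a a<K eq = γ^n≢1 0<a a<K (x^m≡x^[m+d]⇒x^d≡1 γ≢0 c a (just-injective eq))

  -- Each of the three determinants is γᶜ times 1 - γᵃ, γᵃ - γᵇ or 1 - γᵇ, and the character ignores
  -- γᶜ.
  τ-tripleAt : ∀ c {a b} → (a , b) ∈ pairs K → τ (tripleAt c (a , b)) ≡ sign f (a , b)
  τ-tripleAt c {a} {b} ab∈ with ∈-pairs⁻ {K} ab∈
  ... | (0<a , a<K) , (0<b , b<K) , a≢b = begin
    χ (D x y * D y z * D x z)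
      ≡⟨ cong χ (cong₂ _*_ (cong₂ _*_ Dxy Dyz) Dxz) ⟩
    χ (γ ^ c * (1# - γ ^ a) * (γ ^ c * (γ ^ a - γ ^ b)) * (γ ^ c * (1# - γ ^ b)))
      ≡⟨ χ-* (*-≢0 (*-≢0 (γ^-≢0 c) A≢0) (*-≢0 (γ^-≢0 c) AB≢0)) (*-≢0 (γ^-≢0 c) B≢0) ⟩
    χ (γ ^ c * (1# - γ ^ a) * (γ ^ c * (γ ^ a - γ ^ b))) Sign.* χ (γ ^ c * (1# - γ ^ b))
      ≡⟨ cong (Sign._* χ (γ ^ c * (1# - γ ^ b))) (χ-* (*-≢0 (γ^-≢0 c) A≢0) (*-≢0 (γ^-≢0 c) AB≢0)) ⟩
    χ (γ ^ c * (1# - γ ^ a)) Sign.* χ (γ ^ c * (γ ^ a - γ ^ b)) Sign.* χ (γ ^ c * (1# - γ ^ b))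
      ≡⟨ cong₂ Sign._*_ (cong₂ Sign._*_ (χ-γ^* c A≢0) (trans (χ-γ^* c AB≢0) (χ[γ^a-γ^b] a<K b<K a≢b))) (χ-γ^* c B≢0) ⟩
    f a Sign.* f ∣ a - b ∣ Sign.* f b ∎
    where
    open ≡-Reasoning
    x = just (γ ^ c)
    y = just (γ ^ (c ℕ.+ a))
    z = just (γ ^ (c ℕ.+ b))
    A≢0 = 1-γ^-≢0 0<a a<K
    B≢0 = 1-γ^-≢0 0<b b<K
    AB≢0 = γ^a-γ^b≢0 a<K b<K a≢b
    D-1 : ∀ n → D x (just (γ ^ (c ℕ.+ n))) ≡ γ ^ c * (1# - γ ^ n)
    D-1 n = trans (cong (λ w → γ ^ c * 1# - w * 1#) (^-+ γ c n))
      (solve 2 (λ x y → x :* con (+ 1) :- x :* y :* con (+ 1) := x :* (con (+ 1) :- y)) refl (γ ^ c) (γ ^ n))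
    Dxy = D-1 a
    Dxz = D-1 b
    Dyz : D y z ≡ γ ^ c * (γ ^ a - γ ^ b)
    Dyz = trans (cong₂ (λ v w → v * 1# - w * 1#) (^-+ γ c a) (^-+ γ c b))
      (solve 3 (λ x y z → x :* y :* con (+ 1) :- x :* z :* con (+ 1) := x :* (y :- z)) refl (γ ^ c) (γ ^ a) (γ ^ b))

  -- The witness is m - n modulo K, with n (K - 1) in place of -n.
  exponent : ∀ n m → ∃ λ a → a < K × γ ^ (n % K ℕ.+ a) ≡ γ ^ m
  exponent n m = a , m%n<n _ K , (begin
    γ ^ (n % K ℕ.+ a)                         ≡⟨ ^-+ γ (n % K) a ⟩
    γ ^ (n % K) * γ ^ a                       ≡⟨ cong₂ _*_ (sym (γ^-% n)) (sym (γ^-% (n ℕ.* (K ∸ 1) ℕ.+ m))) ⟩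
    γ ^ n * γ ^ (n ℕ.* (K ∸ 1) ℕ.+ m)         ≡⟨ cong (γ ^ n *_) (^-+ γ (n ℕ.* (K ∸ 1)) m) ⟩
    γ ^ n * (γ ^ (n ℕ.* (K ∸ 1)) * γ ^ m)     ≡⟨ sym (*-assoc _ _ _) ⟩
    γ ^ n * γ ^ (n ℕ.* (K ∸ 1)) * γ ^ m       ≡⟨ cong (_* γ ^ m) (γ^n*γ^[n*[K∸1]]≡1 n) ⟩
    1# * γ ^ m                                ≡⟨ *-identityˡ _ ⟩
    γ ^ m                                     ∎)
    where
    open ≡-Reasoning
    a : ℕ
    a = (n ℕ.* (K ∸ 1) ℕ.+ m) % K

  module _ {B : Subset F} (B-isSubgroup : IsSubgroupOfOrder F B K) where

    private
      B⇔γ : ∀ {x} → B x ⇔ ⟨γ⟩ x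
      B⇔γ = B⇔⟨γ⟩ B-isSubgroup

    B? : Decidable B
    B? x = map′ (Equivalence.from B⇔γ ∘ ∈powers⇒⟨γ⟩) (⟨γ⟩⇒∈powers ∘ Equivalence.to B⇔γ) (Any.any? (x ≟_) powers)

    open Orbit B?

    InB-γ^ : ∀ n → InB (just (γ ^ n))
    InB-γ^ n = γ ^ n , Equivalence.from B⇔γ (n , refl) , refl

    InB⇒γ^ : ∀ {p} → InB p → ∃ λ n → just (γ ^ n) ≡ p
    InB⇒γ^ (x , Bx , refl) = let n , γⁿ≡x = Equivalence.to B⇔γ Bx in n , cong just γⁿ≡x

    ∈triples⁺ : ∀ {s T} → InB³ T → Distinct T → τ T ≡ s → T ∈ triples s
    ∈triples⁺ {s} {T} (x∈ , y∈ , z∈) T-distinct τT≡s =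
      let n , x≡ = InB⇒γ^ x∈
          m , y≡ = InB⇒γ^ y∈
          l , z≡ = InB⇒γ^ z∈
          a , a<K , γᶜ⁺ᵃ≡ = exponent n m
          b , b<K , γᶜ⁺ᵇ≡ = exponent n l
          tripleAt≡T = triple≡ (trans (cong just (sym (γ^-% n))) x≡) (trans (cong just γᶜ⁺ᵃ≡) y≡)
            (trans (cong just γᶜ⁺ᵇ≡) z≡)
      in tripleAt∈ (m%n<n n K) a<K b<K tripleAt≡T
      where
      tripleAt∈ : ∀ {c a b} → c < K → a < K → b < K → tripleAt c (a , b) ≡ T → T ∈ triples s
      tripleAt∈ {c} {a} {b} c<K a<K b<K refl = ∈-cartesianProductWith⁺ tripleAt (∈-upTo⁺ c<K)
        (∈-filter⁺ (λ ab → sign f ab Signₚ.≟ s) ab∈ (trans (sym (τ-tripleAt c ab∈)) τT≡s))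
        where
        c+0≡ : just (γ ^ c) ≡ just (γ ^ (c ℕ.+ 0))
        c+0≡ = cong (λ n → just (γ ^ n)) (sym (ℕₚ.+-identityʳ c))
        ab∈ : (a , b) ∈ pairs K
        ab∈ = ∈-pairs⁺ (ℕₚ.n≢0⇒n>0 λ { refl → proj₁ T-distinct c+0≡ }) a<K
          (ℕₚ.n≢0⇒n>0 λ { refl → proj₁ (proj₂ T-distinct) c+0≡ }) b<K (λ { refl → proj₂ (proj₂ T-distinct) refl })

    ∈triples⁻ : ∀ {s T} → T ∈ triples s → InB³ T × Distinct T × τ T ≡ s
    ∈triples⁻ {s} T∈ with ∈-cartesianProductWith⁻ tripleAt (upTo K) (pairsOfSign f K s) T∈
    ... | c , (a , b) , c∈ , ab∈ , refl with ∈-pairsOfSign⁻ {s} ab∈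
    ...   | ab∈pairs , sign≡s =
      (InB-γ^ c , InB-γ^ (c ℕ.+ a) , InB-γ^ (c ℕ.+ b)) , tripleAt-distinct c ab∈pairs
      , trans (τ-tripleAt c ab∈pairs) sign≡s

    subgroupOrbitIs3Design⇔ : OrbitIs3Design F B ⇔ Balanced f K
    subgroupOrbitIs3Design⇔ = ⇔-trans
      (orbitIs3Design⇔ triples triples-unique (mk⇔ ∈triples⁻ (λ (a , b , c) → ∈triples⁺ a b c))
        -- The triple (1, γ, γ²) shows that B contains a triple at all; its points are distinct
        -- because K ≥ 3.
        (∈triples⁺ (InB-γ^ 0 , InB-γ^ 1 , InB-γ^ 2) (tripleAt-distinct 0 12∈) refl))
      (mk⇔ (λ eq → ℕₚ.*-cancelˡ-≡ _ _ K (trans (sym (length-triples Sign.+)) (trans eq (length-triples Sign.-))))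
           (λ eq → trans (length-triples Sign.+) (trans (cong (K ℕ.*_) eq) (sym (length-triples Sign.-)))))
      where
      12∈ : (1 , 2) ∈ pairs K
      12∈ = ∈-pairs⁺ (s≤s z≤n) (ℕₚ.≤-trans (ℕₚ.n≤1+n 2) 3≤K) (s≤s z≤n) 3≤K (λ ())

  -- The condition on the right does not mention B, so one subgroup decides for all; the existence
  -- of ⟨γ⟩ keeps the quantifier over subgroups from being vacuous.
  gives3Design⇔balanced : Gives3Design F K ⇔ Balanced f K
  gives3Design⇔balanced = mk⇔
    (λ design → Equivalence.to (subgroupOrbitIs3Design⇔ ⟨γ⟩-isSubgroup) (design ⟨γ⟩ ⟨γ⟩-isSubgroup))
    (λ balanced B B-isSubgroup → Equivalence.from (subgroupOrbitIs3Design⇔ B-isSubgroup) balanced)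

-- Orders 13 and 26

module SignTables {q : ℕ} (F : FiniteField q) (k : ℕ) (q≡1+52k : q ≡ suc (k ℕ.* 52))
  (α : FiniteField.Carrier F) (generates : IsPrimitiveRoot F α) where
  open FiniteField F
  open FieldProperties F
  open PrimitiveRoot F k q≡1+52k α generates

  private
    h*K≡N : ∀ {h K} → h ℕ.* K ≡ 52 → k ℕ.* h ℕ.* K ≡ N
    h*K≡N {h} {K} eq = trans (ℕₚ.*-assoc k h K) (cong (k ℕ.*_) eq)

    even : ∀ h → parity (k ℕ.* (h ℕ.* 2)) ≡ Sign.+
    even h = trans (cong parity (sym (ℕₚ.*-assoc k h 2))) (parity-*2 (k ℕ.* h))

    -- The generators are α^(52k/13) and α^(52k/26); their exponents 4k = k (2 · 2) and 2k = k (1 ·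
    -- 2) are both even.
    module T₁₃ = CyclicTriples F k q≡1+52k α generates (k ℕ.* 4) 13 (h*K≡N {4} refl) (even 2) (ℕₚ.≤ᵇ⇒≤ 3 13 _)
    module T₂₆ = CyclicTriples F k q≡1+52k α generates (k ℕ.* 2) 26 (h*K≡N {2} refl) (even 1) (ℕₚ.≤ᵇ⇒≤ 3 26 _)

  β : Carrier
  β = α ^ (k ℕ.* 4)

  χ[1-β^1+] : Fin 6 → Sign
  χ[1-β^1+] i = χ (1# - β ^ suc (toℕ i))

  χs : Vec Sign 6
  χs = tabulate χ[1-β^1+]

  f₁₃-table : ∀ {j} → 0 < j → j < 13 → T₁₃.f j ≡ table₁₃ χs j
  f₁₃-table = go _
    where
    reflect : ∀ j {0<j : True (0 ℕ.<? j)} {j<13 : True (j ℕ.<? 13)} → T₁₃.f (13 ∸ j) ≡ T₁₃.f j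
    reflect j {0<j} {j<13} = T₁₃.f-reflect (toWitness 0<j) (toWitness j<13)
    go : ∀ j → 0 < j → j < 13 → T₁₃.f j ≡ table₁₃ χs j
    go 1  _ _ = refl
    go 2  _ _ = refl
    go 3  _ _ = refl
    go 4  _ _ = refl
    go 5  _ _ = refl
    go 6  _ _ = refl
    go 7  _ _ = reflect 6
    go 8  _ _ = reflect 5
    go 9  _ _ = reflect 4
    go 10 _ _ = reflect 3
    go 11 _ _ = reflect 2
    go 12 _ _ = reflect 1
    go (suc (suc (suc (suc (suc (suc (suc (suc (suc (suc (suc (suc (suc j))))))))))))) _ j<13 =
      contradiction j<13 (ℕₚ.m+n≮m 13 j)

  γ : Carrier
  γ = α ^ (k ℕ.* 2)

  γ^[2i]≡β^i : ∀ i → γ ^ (2 ℕ.* i) ≡ β ^ i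
  γ^[2i]≡β^i i = begin
    γ ^ (2 ℕ.* i)       ≡⟨ ^-* γ 2 i ⟩
    (γ ^ 2) ^ i         ≡⟨ cong (_^ i) (sym (^-* α (k ℕ.* 2) 2)) ⟩
    (α ^ (k ℕ.* 2 ℕ.* 2)) ^ i ≡⟨ cong (λ n → (α ^ n) ^ i) (ℕₚ.*-assoc k 2 2) ⟩
    β ^ i               ∎
    where open ≡-Reasoning

  γ¹³≡-1 : γ ^ 13 ≡ - 1#
  γ¹³≡-1 = trans (sym (^-* α (k ℕ.* 2) 13)) (trans (cong (α ^_) (ℕₚ.*-assoc k 2 13)) α^[26k]≡-1)

  -- (1 - γʲ)(1 + γʲ) = 1 - γ²ʲ, and 1 + γʲ = 1 - γʲ⁺¹³.
  f₂₆-double : ∀ j → 0 < j → j < 13 → T₂₆.f (2 ℕ.* j) ≡ T₂₆.f j Sign.* T₂₆.f (j ℕ.+ 13)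
  f₂₆-double j 0<j j<13 = trans (cong χ factor) (χ-* (T₂₆.1-γ^-≢0 0<j (ℕₚ.<-trans j<13 (ℕₚ.≤ᵇ⇒≤ 14 26 _)))
    (T₂₆.1-γ^-≢0 (ℕₚ.≤-trans 0<j (ℕₚ.m≤m+n j 13)) (ℕₚ.+-monoˡ-< 13 j<13)))
    where
    factor : 1# - γ ^ (2 ℕ.* j) ≡ (1# - γ ^ j) * (1# - γ ^ (j ℕ.+ 13))
    factor = trans (cong (λ z → 1# - z) (trans (cong (γ ^_) (cong (j ℕ.+_) (ℕₚ.+-identityʳ j))) (^-+ γ j j)))
      (trans (solve 1 (λ x → con (+ 1) :- x :* x := (con (+ 1) :- x) :* (con (+ 1) :- x :* (:- con (+ 1)))) refl (γ ^ j))
        (cong (λ z → (1# - γ ^ j) * (1# - z)) (sym (trans (^-+ γ j 13) (cong (γ ^ j *_) γ¹³≡-1)))))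

  u : Sign
  u = T₂₆.f 13

  f₂₆-table : ∀ {j} → 0 < j → j < 26 → T₂₆.f j ≡ table₂₆ u χs j
  f₂₆-table = go _
    where
    even-index : ∀ i {0<i : True (0 ℕ.<? i)} {i<13 : True (i ℕ.<? 13)} → T₂₆.f (2 ℕ.* i) ≡ table₁₃ χs i
    even-index i {0<i} {i<13} = trans (cong (λ z → χ (1# - z)) (γ^[2i]≡β^i i)) (f₁₃-table (toWitness 0<i) (toWitness i<13))
    -- For odd j both 2j and j + 13 are even, so their signs are known from order 13, at j and (j +
    -- 13)/2. A sign is its own inverse, which solves the doubling identity for f(j).
    odd-index : ∀ j {s t} {0<j : True (0 ℕ.<? j)} {j<13 : True (j ℕ.<? 13)} →
      T₂₆.f (2 ℕ.* j) ≡ s → T₂₆.f (j ℕ.+ 13) ≡ t → T₂₆.f j ≡ s Sign.* t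
    odd-index j {s} {t} {0<j} {j<13} eq eq′ = Signₚ.*-cancelʳ-≡ t (T₂₆.f j) (s Sign.* t) (begin
      T₂₆.f j Sign.* t                ≡⟨ cong (T₂₆.f j Sign.*_) (sym eq′) ⟩
      T₂₆.f j Sign.* T₂₆.f (j ℕ.+ 13) ≡⟨ sym (f₂₆-double j (toWitness 0<j) (toWitness j<13)) ⟩
      T₂₆.f (2 ℕ.* j)                 ≡⟨ eq ⟩
      s                               ≡⟨ sym (Signₚ.*-identityʳ s) ⟩
      s Sign.* Sign.+                 ≡⟨ cong (s Sign.*_) (sym (Signₚ.s*s≡+ t)) ⟩
      s Sign.* (t Sign.* t)           ≡⟨ sym (Signₚ.*-assoc s t t) ⟩
      s Sign.* t Sign.* t             ∎)
      where open ≡-Reasoning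
    lower : ∀ j → 0 < j → j < 13 → T₂₆.f j ≡ table₂₆ u χs j
    lower 1  _ _ = odd-index 1 (even-index 1) (even-index 7)
    lower 2  _ _ = even-index 1
    lower 3  _ _ = odd-index 3 (even-index 3) (even-index 8)
    lower 4  _ _ = even-index 2
    lower 5  _ _ = odd-index 5 (even-index 5) (even-index 9)
    lower 6  _ _ = even-index 3
    lower 7  _ _ = odd-index 7 (even-index 7) (even-index 10)
    lower 8  _ _ = even-index 4
    lower 9  _ _ = odd-index 9 (even-index 9) (even-index 11)
    lower 10 _ _ = even-index 5
    lower 11 _ _ = odd-index 11 (even-index 11) (even-index 12)
    lower 12 _ _ = even-index 6
    lower (suc (suc (suc (suc (suc (suc (suc (suc (suc (suc (suc (suc (suc j))))))))))))) _ j<13 =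
      contradiction j<13 (ℕₚ.m+n≮m 13 j)
    reflect : ∀ j {0<j : True (0 ℕ.<? j)} {j<13 : True (j ℕ.<? 13)} → T₂₆.f (26 ∸ j) ≡ table₂₆ u χs j
    reflect j {0<j} {j<13} = trans
      (T₂₆.f-reflect (toWitness 0<j) (ℕₚ.<-≤-trans (toWitness j<13) (ℕₚ.m≤m+n 13 13)))
      (lower j (toWitness 0<j) (toWitness j<13))
    go : ∀ j → 0 < j → j < 26 → T₂₆.f j ≡ table₂₆ u χs j
    go j 0<j j<26 with j ℕ.<? 13
    ... | yes j<13 = lower j 0<j j<13
    ... | no  j≮13 = subst (λ i → T₂₆.f i ≡ table₂₆ u χs i) (ℕₚ.m+[n∸m]≡n (ℕₚ.≮⇒≥ j≮13)) (upper (j ∸ 13)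
        (ℕₚ.+-cancelˡ-< 13 (j ∸ 13) 13 (subst (_< 26) (sym (ℕₚ.m+[n∸m]≡n (ℕₚ.≮⇒≥ j≮13))) j<26)))
      where
      upper : ∀ i → i < 13 → T₂₆.f (13 ℕ.+ i) ≡ table₂₆ u χs (13 ℕ.+ i)
      upper 0  _ = refl
      upper 1  _ = reflect 12
      upper 2  _ = reflect 11
      upper 3  _ = reflect 10
      upper 4  _ = reflect 9
      upper 5  _ = reflect 8
      upper 6  _ = reflect 7
      upper 7  _ = reflect 6
      upper 8  _ = reflect 5
      upper 9  _ = reflect 4
      upper 10 _ = reflect 3
      upper 11 _ = reflect 2
      upper 12 _ = reflect 1
      upper (suc (suc (suc (suc (suc (suc (suc (suc (suc (suc (suc (suc (suc i))))))))))))) i<13 =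
        contradiction i<13 (ℕₚ.m+n≮m 13 i)

  gives3Design₁₃⇔admissible : Gives3Design F 13 ⇔ χs ∈ admissible
  gives3Design₁₃⇔admissible = ⇔-trans T₁₃.gives3Design⇔balanced
    (⇔-trans (balanced-cong f₁₃-table) (balanced₁₃⇔admissible χs))

  gives3Design₂₆⇔admissible : Gives3Design F 26 ⇔ χs ∈ admissible
  gives3Design₂₆⇔admissible = ⇔-trans T₂₆.gives3Design⇔balanced
    (⇔-trans (balanced-cong f₂₆-table) (balanced₂₆⇔admissible u χs))

  -- The character has one value at each nonzero element, so a sequence satisfying `ChiSeqIs` can
  -- only be `χs`; conversely 1 - βⁱ ≠ 0 for 1 ≤ i ≤ 6, since β has order 13.
  chiSeq⇔admissible : (Σ _ λ s → s ∈ admissible × ChiSeqIs F β s) ⇔ χs ∈ admissible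
  chiSeq⇔admissible = mk⇔
    (λ (s , s∈ , chi) → subst (_∈ admissible)
      (trans (sym (tabulate∘lookup s)) (tabulate-cong λ i → sym (ChiIs⇒χ≡ (lookup s i) (chi i)))) s∈)
    (λ χs∈ → χs , χs∈ , λ i → subst (ChiIs F (1# - β ^ suc (toℕ i))) (sym (lookup∘tabulate χ[1-β^1+] i))
      (χ-ChiIs (T₁₃.1-γ^-≢0 (s≤s z≤n) (ℕₚ.≤-trans (s≤s (Finₚ.toℕ<n i)) (ℕₚ.m≤m+n 7 6)))))

theorem5p1 : (q : ℕ) → q % 52 ≡ 1 → (F : FiniteField q) →
    (α : FiniteField.Carrier F) → IsPrimitiveRoot F α →
    (Gives3Design F 13 ⇔ Gives3Design F 26)
    × (Gives3Design F 13 ⇔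
    Σ _ λ s → s ∈ admissible
    × ChiSeqIs F (FiniteField._^_ F α ((q ∸ 1) / 13)) s)
theorem5p1 q q%52≡1 F α generates =
    ⇔-trans gives3Design₁₃⇔admissible (⇔-sym gives3Design₂₆⇔admissible)
  -- The exponent (q - 1)/13 of the statement equals the 4k in `β` only propositionally, hence the
  -- transport.
  , subst (λ n → Gives3Design F 13 ⇔ (Σ _ λ s → s ∈ admissible × ChiSeqIs F (α ^ n) s)) (sym [q-1]/13≡4k)
      (⇔-trans gives3Design₁₃⇔admissible (⇔-sym chiSeq⇔admissible))
  where
  open FiniteField F using (_^_)
  k : ℕ
  k = q / 52
  q≡1+52k : q ≡ suc (k ℕ.* 52)
  q≡1+52k = trans (m≡m%n+[m/n]*n q 52) (cong (ℕ._+ k ℕ.* 52) q%52≡1)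
  [q-1]/13≡4k : (q ∸ 1) / 13 ≡ k ℕ.* 4
  [q-1]/13≡4k = trans (cong (λ m → (m ∸ 1) / 13) q≡1+52k)
    (trans (cong (_/ 13) (sym (ℕₚ.*-assoc k 4 13))) (m*n/n≡m (k ℕ.* 4) 13))
  open SignTables F k q≡1+52k α generates
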